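{- Let $m\in\mathbb{N}_0$ and let $p_1,p_2,p_3$ be primes such that $p_1<p_2<p_3$. For any given integer $j$, define $$\Delta_j:=\mathbf{1}_{[0,[j/p_2]]}(b_{0,j})-\mathbf{1}_{[0,[j/p_2]]}(b_{1,j}),$$ where $b_{0,j},b_{1,j}\in P_1:=[0,p_1-1]$ are such that $p_2b_{0,j}\equiv j\pmod{p_1}$ and $p_2b_{1,j}\equiv j-1\pmod{p_1}$. Then the following identities hold. First, $$\mathcal{H}_m(\mathcal{Z}_{p_1p_2}^{*})=\mathbf{1}_{P_1}(\{m\}_{p_2})\,\mathcal{H}_{[m/p_2]}(\mathcal{Z}_{p_1}^{*}).$$ Second, $$(-1)^m\mathcal{E}_m(\mathcal{Z}_{p_1p_2}^{*})=\Delta_m\quad\text{when } m\le|\mathcal{Z}_{p_1p_2}^{*}|.$$ Third, $$\mathcal{H}_m(\mathcal{Z}_{p_1p_2p_3}^{*})=\sum_{j\in I}\mathbf{1}_{P_1}(\{j\}_{p_2})\,\Delta_{m-jp_3}\,\mathcal{H}_{[j/p_2]}(\mathcal{Z}_{p_1}^{*}),$$ where $I:=\left[0,\left[\frac{m}{p_3}\right]\right]\cap\left[\frac{m}{p_3}-\frac{(p_1-1)(p_2-1)}{p_3},+\infty\right)$. Fourth, $$(-1)^m\mathcal{E}_m(\mathcal{Z}_{p_1p_2p_3}^{*})=\sum_{j=0}^{[m/p_3]}\mathbf{1}_{P_1}(\{m-jp_3\}_{p_2})\,\mathbf{1}_{P_1}\left(\left\{\left[\frac{m-jp_3}{p_2}\right]\right\}_{p_2}\right)\Delta_j\,\mathcal{H}_{\left[\left[\frac{m-jp_3}{p_2}\right]/p_2\right]}(\mathcal{Z}_{p_1}^{*})$$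 when $m\le|\mathcal{Z}_{p_1p_2p_3}^{*}|$.
   Context: $\mathbb{N}_0=\{0,1,2,\ldots\}$. $[t]$ is the integer part of the real number $t$ (while $[a,b]$ is a closed interval); $\{m\}_n$ is the remainder of the division of $m$ by $n$; $\mathbf{1}_A(x)=1$ if $x\in A$ and $0$ otherwise. The numbers $b_{0,j},b_{1,j}$ are integers, and a sum over $j\in I$ runs over the integers $j$ in the interval $I$. $\mathcal{Z}_n^*$ is the set of primitive $n$th roots of unity in $\mathbb{C}$, and $|\mathcal{Z}_n^*|=\varphi(n)$ is its cardinality ($\varphi$ the Euler totient function). For a finite nonempty set $A=\{z_1,\ldots,z_r\}$ of complex numbers, the elementary symmetric polynomials are $\mathcal{E}_0(A):=1$, $\mathcal{E}_m(A):=\sum_{1\le j_1<\cdots<j_m\le r}z_{j_1}\cdots z_{j_m}$ for $1\le m\le r$, $\mathcal{E}_m(A):=0$ for $m>r$; the complete homogeneous symmetric polynomials are $\mathcal{H}_0(A):=1$ and $\mathcal{H}_m(A):=\sum_{1\le j_1\le\cdots\le j_m\le r}z_{j_1}\cdots z_{j_m}$ for $m\ge1$.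
   Formalization: The fourth identity as printed fails (p=(2,3,5), m=3: left −1, right +1); proved instead with summand 1_{P1}({m−jp3}_{p2}) Δ_j H_{[(m−jp3)/p2]}(Z_{p1}^*), i.e. without the second indicator and the second division by p2. -}

module Defs where

open import Algebra.Bundles using (CommutativeRing; Semiring)
import Algebra.Consequences.Setoid as AlgebraConsequences
open import Algebra.Definitions
  using (Associative; Commutative; LeftIdentity; LeftInverse; _DistributesOverˡ_; Congruent₁; Congruent₂)
import Algebra.Definitions.RawSemiring as RawSemiringDefinitions
open import Data.Bool.Base using (if_then_else_)
open import Data.Fin.Base using (Fin)
import Data.Fin.Properties as Fin
open import Data.Integer.Base as ℤ using (ℤ; +_; 0ℤ; 1ℤ)
import Data.Integer.DivMod as ℤ
import Data.Integer.Divisibility as ℤ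
import Data.Integer.Properties as ℤ
open import Data.List.Base
  using (List; []; _∷_; foldr; map; filter; length; lookup; upTo; allFin; cartesianProductWith)
import Data.List.Membership.Setoid as SetoidMembership
open import Data.List.Relation.Unary.Linked using (linked?)
import Data.List.Relation.Unary.Unique.Setoid as SetoidUnique
open import Data.Nat.Base as ℕ using (ℕ; zero; suc)
import Data.Nat.Properties as ℕ
open import Data.Product.Base using (_×_; _,_; proj₁; proj₂; ∃; ∃-syntax)
open import Data.Rational.Base as ℚ using (ℚ; 0ℚ; 1ℚ; ½; ∣_∣)
import Data.Rational.Properties as ℚ
open import Data.Rational.Solver using (module +-*-Solver)
open import Function.Base using (_∘_)
open import Level using (0ℓ)
open import Relation.Binary.Bundles using (Setoid)
open import Relation.Binary.Structures using (IsEquivalence)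
open import Relation.Binary.PropositionalEquality.Core using (_≡_; refl; sym; trans; cong; subst)
open import Relation.Nullary.Decidable using (does; _×-dec_)
open import Relation.Nullary.Negation using (¬_)

-- The real numbers, as Cauchy sequences of rationals. The existential
-- quantifiers supply the moduli, so no choice principle is needed.

Cauchy : (ℕ → ℚ) → Set
Cauchy f = ∀ ε → 0ℚ ℚ.< ε →
  ∃[ N ] ∀ m n → N ℕ.≤ m → N ℕ.≤ n → ∣ f m ℚ.- f n ∣ ℚ.< ε

-- Without η, so that unification treats the operations below as rigid.
record ℝ : Set where
  no-eta-equality
  constructor mkℝ
  field
    seq    : ℕ → ℚ
    cauchy : Cauchy seq

open ℝ public

infix 4 _≈ᴿ_

record _≈ᴿ_ (x y : ℝ) : Set where
  no-eta-equality
  constructor mk≈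
  field
    close : ∀ ε → 0ℚ ℚ.< ε →
      ∃[ N ] ∀ n → N ℕ.≤ n → ∣ seq x n ℚ.- seq y n ∣ ℚ.< ε

open _≈ᴿ_ public

private
  open +-*-Solver using (solve; _:=_; _:+_; _:*_; _:-_; :-_; con)

  ½-pos : ∀ ε → 0ℚ ℚ.< ε → 0ℚ ℚ.< ½ ℚ.* ε
  ½-pos ε ε>0 = subst (ℚ._< ½ ℚ.* ε) (ℚ.*-zeroʳ ½) (ℚ.*-monoʳ-<-pos ½ ε>0)

  ½+½ : ∀ ε → ½ ℚ.* ε ℚ.+ ½ ℚ.* ε ≡ ε
  ½+½ = solve 1 (λ e → con ½ :* e :+ con ½ :* e := e) refl

  sum-diff : ∀ a b c d → (a ℚ.+ c) ℚ.- (b ℚ.+ d) ≡ (a ℚ.- b) ℚ.+ (c ℚ.- d)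
  sum-diff = solve 4 (λ a b c d → (a :+ c) :- (b :+ d) := (a :- b) :+ (c :- d)) refl

  prod-diff : ∀ a b c d → a ℚ.* c ℚ.- b ℚ.* d ≡ a ℚ.* (c ℚ.- d) ℚ.+ d ℚ.* (a ℚ.- b)
  prod-diff = solve 4 (λ a b c d → a :* c :- b :* d := a :* (c :- d) :+ d :* (a :- b)) refl

  neg-diff : ∀ a b → ℚ.- a ℚ.- ℚ.- b ≡ ℚ.- (a ℚ.- b)
  neg-diff = solve 2 (λ a b → :- a :- (:- b) := :- (a :- b)) refl

  diff-swap : ∀ a b → b ℚ.- a ≡ ℚ.- (a ℚ.- b)
  diff-swap = solve 2 (λ a b → b :- a := :- (a :- b)) refl

  diff-split : ∀ a b c → a ℚ.- c ≡ (a ℚ.- b) ℚ.+ (b ℚ.- c)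
  diff-split = solve 3 (λ a b c → a :- c := (a :- b) :+ (b :- c)) refl

  diff-cancel : ∀ a b → a ℚ.+ (b ℚ.- a) ≡ b
  diff-cancel = solve 2 (λ a b → a :+ (b :- a) := b) refl

  add-< : ∀ {ε} a b c → c ≡ a ℚ.+ b →
          ∣ a ∣ ℚ.< ½ ℚ.* ε → ∣ b ∣ ℚ.< ½ ℚ.* ε → ∣ c ∣ ℚ.< ε
  add-< {ε} a b .(a ℚ.+ b) refl p q = subst (∣ a ℚ.+ b ∣ ℚ.<_) (½+½ ε)
    (ℚ.≤-<-trans (ℚ.∣p+q∣≤∣p∣+∣q∣ a b) (ℚ.+-mono-< p q))

  ∣0∣< : ∀ {ε} a → a ≡ 0ℚ → 0ℚ ℚ.< ε → ∣ a ∣ ℚ.< ε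
  ∣0∣< .0ℚ refl ε>0 = ε>0

  ∣-∣< : ∀ {ε} a b → b ≡ ℚ.- a → ∣ a ∣ ℚ.< ε → ∣ b ∣ ℚ.< ε
  ∣-∣< {ε} a .(ℚ.- a) refl = subst (ℚ._< ε) (sym (ℚ.∣-p∣≡∣p∣ a))

  bounded : ∀ {f} → Cauchy f → ∃[ K ] 0ℚ ℚ.< K × ∃[ N ] ∀ n → N ℕ.≤ n → ∣ f n ∣ ℚ.< K
  bounded {f} c with c 1ℚ (ℚ.positive⁻¹ 1ℚ)
  ... | N , h = ∣ f N ∣ ℚ.+ 1ℚ
              , ℚ.+-mono-≤-< (ℚ.0≤∣p∣ (f N)) (ℚ.positive⁻¹ 1ℚ)
              , N , bound
    where
    bound : ∀ n → N ℕ.≤ n → ∣ f n ∣ ℚ.< ∣ f N ∣ ℚ.+ 1ℚ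
    bound n N≤n = ℚ.≤-<-trans
      (subst (λ a → ∣ a ∣ ℚ.≤ ∣ f N ∣ ℚ.+ ∣ f n ℚ.- f N ∣)
        (diff-cancel (f N) (f n))
        (ℚ.∣p+q∣≤∣p∣+∣q∣ (f N) (f n ℚ.- f N)))
      (ℚ.+-monoʳ-< ∣ f N ∣ (h n N N≤n ℕ.≤-refl))

  scale : ∀ K ε → 0ℚ ℚ.< K → 0ℚ ℚ.< ε →
    ∃[ δ ] 0ℚ ℚ.< δ × (∀ a b → ∣ a ∣ ℚ.< K → ∣ b ∣ ℚ.< δ → ∣ a ℚ.* b ∣ ℚ.< ε)
  scale K ε K>0 ε>0 = δ , δ>0 , bound
    where
    instance
      K⁺ : ℚ.Positive K
      K⁺ = ℚ.positive K>0
      K≢0 : ℚ.NonZero K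
      K≢0 = ℚ.pos⇒nonZero K
      1/K⁺ : ℚ.Positive (ℚ.1/ K)
      1/K⁺ = ℚ.1/pos⇒pos K
    δ = ℚ.1/ K ℚ.* ε
    δ>0 : 0ℚ ℚ.< δ
    δ>0 = subst (ℚ._< δ) (ℚ.*-zeroʳ (ℚ.1/ K)) (ℚ.*-monoʳ-<-pos (ℚ.1/ K) ε>0)
    Kδ≡ε : K ℚ.* δ ≡ ε
    Kδ≡ε = trans (sym (ℚ.*-assoc K (ℚ.1/ K) ε))
             (trans (cong (ℚ._* ε) (ℚ.*-inverseʳ K)) (ℚ.*-identityˡ ε))
    bound : ∀ a b → ∣ a ∣ ℚ.< K → ∣ b ∣ ℚ.< δ → ∣ a ℚ.* b ∣ ℚ.< ε
    bound a b a<K b<δ = begin-strict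
      ∣ a ℚ.* b ∣       ≡⟨ ℚ.∣p*q∣≡∣p∣*∣q∣ a b ⟩
      ∣ a ∣ ℚ.* ∣ b ∣   ≤⟨ ℚ.*-monoʳ-≤-nonNeg ∣ b ∣ {{ℚ.nonNegative (ℚ.0≤∣p∣ b)}} (ℚ.<⇒≤ a<K) ⟩
      K ℚ.* ∣ b ∣       <⟨ ℚ.*-monoʳ-<-pos K b<δ ⟩
      K ℚ.* δ           ≡⟨ Kδ≡ε ⟩
      ε                 ∎
      where open ℚ.≤-Reasoning

  ⊔⁻ˡ : ∀ {m n o} → m ℕ.⊔ n ℕ.≤ o → m ℕ.≤ o
  ⊔⁻ˡ {m} {n} = ℕ.m⊔n≤o⇒m≤o m n

  ⊔⁻ʳ : ∀ {m n o} → m ℕ.⊔ n ℕ.≤ o → n ℕ.≤ o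
  ⊔⁻ʳ {m} {n} = ℕ.m⊔n≤o⇒n≤o m n

infixl 6 _+ᴿ_
infixl 7 _*ᴿ_
infix  8 -ᴿ_

fromℚ : ℚ → ℝ
fromℚ q .seq    _     = q
fromℚ q .cauchy ε ε>0 = 0 , λ _ _ _ _ → ∣0∣< (q ℚ.- q) (ℚ.+-inverseʳ q) ε>0

private
  Close : ℚ → ℚ → ℚ → Set
  Close ε p q = ∣ p ℚ.- q ∣ ℚ.< ε

  +-close : ∀ ε a b c d → Close (½ ℚ.* ε) a b → Close (½ ℚ.* ε) c d → Close ε (a ℚ.+ c) (b ℚ.+ d)
  +-close ε a b c d = add-< {ε} (a ℚ.- b) (c ℚ.- d) ((a ℚ.+ c) ℚ.- (b ℚ.+ d)) (sum-diff a b c d)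

  neg-close : ∀ ε a b → Close ε a b → Close ε (ℚ.- a) (ℚ.- b)
  neg-close ε a b = ∣-∣< {ε} (a ℚ.- b) (ℚ.- a ℚ.- ℚ.- b) (neg-diff a b)

  *-close : ∀ ε a b c d →
    ∣ a ℚ.* (c ℚ.- d) ∣ ℚ.< ½ ℚ.* ε → ∣ d ℚ.* (a ℚ.- b) ∣ ℚ.< ½ ℚ.* ε →
    Close ε (a ℚ.* c) (b ℚ.* d)
  *-close ε a b c d =
    add-< {ε} (a ℚ.* (c ℚ.- d)) (d ℚ.* (a ℚ.- b)) (a ℚ.* c ℚ.- b ℚ.* d) (prod-diff a b c d)

  close-sym : ∀ ε a b → Close ε a b → Close ε b a
  close-sym ε a b = ∣-∣< {ε} (a ℚ.- b) (b ℚ.- a) (diff-swap a b)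

  close-trans : ∀ ε a b c → Close (½ ℚ.* ε) a b → Close (½ ℚ.* ε) b c → Close ε a c
  close-trans ε a b c = add-< {ε} (a ℚ.- b) (b ℚ.- c) (a ℚ.- c) (diff-split a b c)

_+ᴿ_ : ℝ → ℝ → ℝ
(x +ᴿ y) .seq n = seq x n ℚ.+ seq y n
(x +ᴿ y) .cauchy ε ε>0 =
  let M , hx = cauchy x (½ ℚ.* ε) (½-pos ε ε>0)
      N , hy = cauchy y (½ ℚ.* ε) (½-pos ε ε>0)
  in M ℕ.⊔ N , λ m n m≥ n≥ →
    +-close ε (seq x m) (seq x n) (seq y m) (seq y n)
      (hx m n (⊔⁻ˡ {M} {N} m≥) (⊔⁻ˡ {M} {N} n≥))
      (hy m n (⊔⁻ʳ {M} {N} m≥) (⊔⁻ʳ {M} {N} n≥))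

-ᴿ_ : ℝ → ℝ
(-ᴿ x) .seq n = ℚ.- seq x n
(-ᴿ x) .cauchy ε ε>0 =
  let N , h = cauchy x ε ε>0
  in N , λ m n m≥ n≥ → neg-close ε (seq x m) (seq x n) (h m n m≥ n≥)

_*ᴿ_ : ℝ → ℝ → ℝ
(x *ᴿ y) .seq n = seq x n ℚ.* seq y n
(x *ᴿ y) .cauchy ε ε>0 =
  let K , K>0 , M , bx = bounded (cauchy x)
      L , L>0 , N , by = bounded (cauchy y)
      δ , δ>0 , sx = scale K (½ ℚ.* ε) K>0 (½-pos ε ε>0)
      η , η>0 , sy = scale L (½ ℚ.* ε) L>0 (½-pos ε ε>0)
      P , hy = cauchy y δ δ>0
      Q , hx = cauchy x η η>0
  in (M ℕ.⊔ N) ℕ.⊔ (P ℕ.⊔ Q) , λ m n m≥ n≥ →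
    *-close ε (seq x m) (seq x n) (seq y m) (seq y n)
      (sx (seq x m) (seq y m ℚ.- seq y n)
        (bx m (⊔⁻ˡ {M} {N} (⊔⁻ˡ {M ℕ.⊔ N} {P ℕ.⊔ Q} m≥)))
        (hy m n (⊔⁻ˡ {P} {Q} (⊔⁻ʳ {M ℕ.⊔ N} {P ℕ.⊔ Q} m≥)) (⊔⁻ˡ {P} {Q} (⊔⁻ʳ {M ℕ.⊔ N} {P ℕ.⊔ Q} n≥))))
      (sy (seq y n) (seq x m ℚ.- seq x n)
        (by n (⊔⁻ʳ {M} {N} (⊔⁻ˡ {M ℕ.⊔ N} {P ℕ.⊔ Q} n≥)))
        (hx m n (⊔⁻ʳ {P} {Q} (⊔⁻ʳ {M ℕ.⊔ N} {P ℕ.⊔ Q} m≥)) (⊔⁻ʳ {P} {Q} (⊔⁻ʳ {M ℕ.⊔ N} {P ℕ.⊔ Q} n≥))))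

≈ᴿ-pointwise : ∀ {x y} → (∀ n → seq x n ≡ seq y n) → x ≈ᴿ y
≈ᴿ-pointwise {x} {y} eq .close ε ε>0 = 0 , λ n _ →
  ∣0∣< _ (trans (cong (ℚ._- seq y n) (eq n)) (ℚ.+-inverseʳ (seq y n))) ε>0

≈ᴿ-refl : ∀ {x} → x ≈ᴿ x
≈ᴿ-refl = ≈ᴿ-pointwise λ _ → refl

≈ᴿ-sym : ∀ {x y} → x ≈ᴿ y → y ≈ᴿ x
≈ᴿ-sym {x} {y} x≈y .close ε ε>0 =
  let N , h = close x≈y ε ε>0
  in N , λ n n≥ → close-sym ε (seq x n) (seq y n) (h n n≥)

≈ᴿ-trans : ∀ {x y z} → x ≈ᴿ y → y ≈ᴿ z → x ≈ᴿ z
≈ᴿ-trans {x} {y} {z} x≈y y≈z .close ε ε>0 =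
  let M , h = close x≈y (½ ℚ.* ε) (½-pos ε ε>0)
      N , k = close y≈z (½ ℚ.* ε) (½-pos ε ε>0)
  in M ℕ.⊔ N , λ n n≥ →
    close-trans ε (seq x n) (seq y n) (seq z n)
      (h n (⊔⁻ˡ {M} {N} n≥)) (k n (⊔⁻ʳ {M} {N} n≥))

+ᴿ-cong : ∀ {x x′ y y′} → x ≈ᴿ x′ → y ≈ᴿ y′ → x +ᴿ y ≈ᴿ x′ +ᴿ y′
+ᴿ-cong {x} {x′} {y} {y′} p q .close ε ε>0 =
  let M , h = close p (½ ℚ.* ε) (½-pos ε ε>0)
      N , k = close q (½ ℚ.* ε) (½-pos ε ε>0)
  in M ℕ.⊔ N , λ n n≥ →
    +-close ε (seq x n) (seq x′ n) (seq y n) (seq y′ n)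
      (h n (⊔⁻ˡ {M} {N} n≥)) (k n (⊔⁻ʳ {M} {N} n≥))

-ᴿ-cong : ∀ {x x′} → x ≈ᴿ x′ → -ᴿ x ≈ᴿ -ᴿ x′
-ᴿ-cong {x} {x′} p .close ε ε>0 =
  let N , h = close p ε ε>0
  in N , λ n n≥ → neg-close ε (seq x n) (seq x′ n) (h n n≥)

*ᴿ-cong : ∀ {x x′ y y′} → x ≈ᴿ x′ → y ≈ᴿ y′ → x *ᴿ y ≈ᴿ x′ *ᴿ y′
*ᴿ-cong {x} {x′} {y} {y′} p q .close ε ε>0 =
  let K , K>0 , M , bx = bounded (cauchy x)
      L , L>0 , N , by = bounded (cauchy y′)
      δ , δ>0 , sx = scale K (½ ℚ.* ε) K>0 (½-pos ε ε>0)
      η , η>0 , sy = scale L (½ ℚ.* ε) L>0 (½-pos ε ε>0)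
      P , hq = close q δ δ>0
      Q , hp = close p η η>0
  in (M ℕ.⊔ N) ℕ.⊔ (P ℕ.⊔ Q) , λ n n≥ →
    *-close ε (seq x n) (seq x′ n) (seq y n) (seq y′ n)
      (sx (seq x n) (seq y n ℚ.- seq y′ n)
        (bx n (⊔⁻ˡ {M} {N} (⊔⁻ˡ {M ℕ.⊔ N} {P ℕ.⊔ Q} n≥)))
        (hq n (⊔⁻ˡ {P} {Q} (⊔⁻ʳ {M ℕ.⊔ N} {P ℕ.⊔ Q} n≥))))
      (sy (seq y′ n) (seq x n ℚ.- seq x′ n)
        (by n (⊔⁻ʳ {M} {N} (⊔⁻ˡ {M ℕ.⊔ N} {P ℕ.⊔ Q} n≥)))
        (hp n (⊔⁻ʳ {P} {Q} (⊔⁻ʳ {M ℕ.⊔ N} {P ℕ.⊔ Q} n≥))))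

infix 5 _+i_

record ℂ : Set where
  no-eta-equality
  constructor _+i_
  field
    re im : ℝ

open ℂ public

infix  4 _≈ᶜ_
infixl 6 _+ᶜ_
infixl 7 _*ᶜ_
infix  8 -ᶜ_

record _≈ᶜ_ (z w : ℂ) : Set where
  constructor _,_
  field
    re≈ : re z ≈ᴿ re w
    im≈ : im z ≈ᴿ im w

0ᶜ : ℂ
0ᶜ = fromℚ 0ℚ +i fromℚ 0ℚ

1ᶜ : ℂ
1ᶜ = fromℚ 1ℚ +i fromℚ 0ℚ

_+ᶜ_ : ℂ → ℂ → ℂ
(z +ᶜ w) .re = re z +ᴿ re w
(z +ᶜ w) .im = im z +ᴿ im w

-ᶜ_ : ℂ → ℂ
(-ᶜ z) .re = -ᴿ re z
(-ᶜ z) .im = -ᴿ im z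

_*ᶜ_ : ℂ → ℂ → ℂ
(z *ᶜ w) .re = re z *ᴿ re w +ᴿ -ᴿ (im z *ᴿ im w)
(z *ᶜ w) .im = re z *ᴿ im w +ᴿ im z *ᴿ re w

fromℤ : ℤ → ℂ
fromℤ k = fromℚ (k ℚ./ 1) +i fromℚ 0ℚ

private
  *-assoc-re : ∀ a b c d e f →
    (a ℚ.* c ℚ.+ ℚ.- (b ℚ.* d)) ℚ.* e ℚ.+ ℚ.- ((a ℚ.* d ℚ.+ b ℚ.* c) ℚ.* f)
      ≡ a ℚ.* (c ℚ.* e ℚ.+ ℚ.- (d ℚ.* f)) ℚ.+ ℚ.- (b ℚ.* (c ℚ.* f ℚ.+ d ℚ.* e))
  *-assoc-re = solve 6 (λ a b c d e f →
    (a :* c :+ :- (b :* d)) :* e :+ :- ((a :* d :+ b :* c) :* f)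
      := a :* (c :* e :+ :- (d :* f)) :+ :- (b :* (c :* f :+ d :* e))) refl

  *-assoc-im : ∀ a b c d e f →
    (a ℚ.* c ℚ.+ ℚ.- (b ℚ.* d)) ℚ.* f ℚ.+ (a ℚ.* d ℚ.+ b ℚ.* c) ℚ.* e
      ≡ a ℚ.* (c ℚ.* f ℚ.+ d ℚ.* e) ℚ.+ b ℚ.* (c ℚ.* e ℚ.+ ℚ.- (d ℚ.* f))
  *-assoc-im = solve 6 (λ a b c d e f →
    (a :* c :+ :- (b :* d)) :* f :+ (a :* d :+ b :* c) :* e
      := a :* (c :* f :+ d :* e) :+ b :* (c :* e :+ :- (d :* f))) refl

  distribˡ-re : ∀ a b c d e f →
    a ℚ.* (c ℚ.+ e) ℚ.+ ℚ.- (b ℚ.* (d ℚ.+ f))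
      ≡ (a ℚ.* c ℚ.+ ℚ.- (b ℚ.* d)) ℚ.+ (a ℚ.* e ℚ.+ ℚ.- (b ℚ.* f))
  distribˡ-re = solve 6 (λ a b c d e f →
    a :* (c :+ e) :+ :- (b :* (d :+ f))
      := (a :* c :+ :- (b :* d)) :+ (a :* e :+ :- (b :* f))) refl

  distribˡ-im : ∀ a b c d e f →
    a ℚ.* (d ℚ.+ f) ℚ.+ b ℚ.* (c ℚ.+ e)
      ≡ (a ℚ.* d ℚ.+ b ℚ.* c) ℚ.+ (a ℚ.* f ℚ.+ b ℚ.* e)
  distribˡ-im = solve 6 (λ a b c d e f →
    a :* (d :+ f) :+ b :* (c :+ e)
      := (a :* d :+ b :* c) :+ (a :* f :+ b :* e)) refl

  *-comm-re : ∀ a b c d → a ℚ.* c ℚ.+ ℚ.- (b ℚ.* d) ≡ c ℚ.* a ℚ.+ ℚ.- (d ℚ.* b)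
  *-comm-re = solve 4 (λ a b c d → a :* c :+ :- (b :* d) := c :* a :+ :- (d :* b)) refl

  *-comm-im : ∀ a b c d → a ℚ.* d ℚ.+ b ℚ.* c ≡ c ℚ.* b ℚ.+ d ℚ.* a
  *-comm-im = solve 4 (λ a b c d → a :* d :+ b :* c := c :* b :+ d :* a) refl

  *-identityˡ-re : ∀ a b → 1ℚ ℚ.* a ℚ.+ ℚ.- (0ℚ ℚ.* b) ≡ a
  *-identityˡ-re = solve 2 (λ a b → con 1ℚ :* a :+ :- (con 0ℚ :* b) := a) refl

  *-identityˡ-im : ∀ a b → 1ℚ ℚ.* b ℚ.+ 0ℚ ℚ.* a ≡ b
  *-identityˡ-im = solve 2 (λ a b → con 1ℚ :* b :+ con 0ℚ :* a := b) refl

  ≈ᶜ-pointwise : ∀ {z w} → (∀ n → seq (re z) n ≡ seq (re w) n) →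
                 (∀ n → seq (im z) n ≡ seq (im w) n) → z ≈ᶜ w
  ≈ᶜ-pointwise p q = ≈ᴿ-pointwise p , ≈ᴿ-pointwise q

  ℜ ℑ : ℂ → ℕ → ℚ
  ℜ = seq ∘ re
  ℑ = seq ∘ im

≈ᶜ-isEquivalence : IsEquivalence _≈ᶜ_
≈ᶜ-isEquivalence = record
  { refl  = ≈ᴿ-refl , ≈ᴿ-refl
  ; sym   = λ (p , q) → ≈ᴿ-sym p , ≈ᴿ-sym q
  ; trans = λ (p , q) (r , s) → ≈ᴿ-trans p r , ≈ᴿ-trans q s
  }

ℂ-setoid : Setoid 0ℓ 0ℓ
ℂ-setoid = record { isEquivalence = ≈ᶜ-isEquivalence }

+ᶜ-cong : Congruent₂ _≈ᶜ_ _+ᶜ_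
+ᶜ-cong (p , q) (r , s) = +ᴿ-cong p r , +ᴿ-cong q s

-ᶜ-cong : Congruent₁ _≈ᶜ_ -ᶜ_
-ᶜ-cong (p , q) = -ᴿ-cong p , -ᴿ-cong q

*ᶜ-cong : Congruent₂ _≈ᶜ_ _*ᶜ_
*ᶜ-cong (p , q) (r , s) =
  +ᴿ-cong (*ᴿ-cong p r) (-ᴿ-cong (*ᴿ-cong q s)) , +ᴿ-cong (*ᴿ-cong p s) (*ᴿ-cong q r)

+ᶜ-assoc : Associative _≈ᶜ_ _+ᶜ_
+ᶜ-assoc x y z = ≈ᶜ-pointwise
  (λ n → ℚ.+-assoc (ℜ x n) (ℜ y n) (ℜ z n))
  (λ n → ℚ.+-assoc (ℑ x n) (ℑ y n) (ℑ z n))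

+ᶜ-comm : Commutative _≈ᶜ_ _+ᶜ_
+ᶜ-comm x y = ≈ᶜ-pointwise (λ n → ℚ.+-comm (ℜ x n) (ℜ y n)) (λ n → ℚ.+-comm (ℑ x n) (ℑ y n))

+ᶜ-identityˡ : LeftIdentity _≈ᶜ_ 0ᶜ _+ᶜ_
+ᶜ-identityˡ x = ≈ᶜ-pointwise (λ n → ℚ.+-identityˡ (ℜ x n)) (λ n → ℚ.+-identityˡ (ℑ x n))

-ᶜ-inverseˡ : LeftInverse _≈ᶜ_ 0ᶜ -ᶜ_ _+ᶜ_
-ᶜ-inverseˡ x = ≈ᶜ-pointwise (λ n → ℚ.+-inverseˡ (ℜ x n)) (λ n → ℚ.+-inverseˡ (ℑ x n))

*ᶜ-assoc : Associative _≈ᶜ_ _*ᶜ_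
*ᶜ-assoc x y z = ≈ᶜ-pointwise
  (λ n → *-assoc-re (ℜ x n) (ℑ x n) (ℜ y n) (ℑ y n) (ℜ z n) (ℑ z n))
  (λ n → *-assoc-im (ℜ x n) (ℑ x n) (ℜ y n) (ℑ y n) (ℜ z n) (ℑ z n))

*ᶜ-comm : Commutative _≈ᶜ_ _*ᶜ_
*ᶜ-comm x y = ≈ᶜ-pointwise
  (λ n → *-comm-re (ℜ x n) (ℑ x n) (ℜ y n) (ℑ y n))
  (λ n → *-comm-im (ℜ x n) (ℑ x n) (ℜ y n) (ℑ y n))

*ᶜ-identityˡ : LeftIdentity _≈ᶜ_ 1ᶜ _*ᶜ_
*ᶜ-identityˡ x = ≈ᶜ-pointwise
  (λ n → *-identityˡ-re (ℜ x n) (ℑ x n))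
  (λ n → *-identityˡ-im (ℜ x n) (ℑ x n))

*ᶜ-distribˡ-+ᶜ : _DistributesOverˡ_ _≈ᶜ_ _*ᶜ_ _+ᶜ_
*ᶜ-distribˡ-+ᶜ x y z = ≈ᶜ-pointwise
  (λ n → distribˡ-re (ℜ x n) (ℑ x n) (ℜ y n) (ℑ y n) (ℜ z n) (ℑ z n))
  (λ n → distribˡ-im (ℜ x n) (ℑ x n) (ℜ y n) (ℑ y n) (ℜ z n) (ℑ z n))

ℂ-commutativeRing : CommutativeRing 0ℓ 0ℓ
ℂ-commutativeRing = record
  { isCommutativeRing = record
    { isRing = record
      { +-isAbelianGroup = record
        { isGroup = record
          { isMonoid = record
            { isSemigroup = record
              { isMagma = record { isEquivalence = ≈ᶜ-isEquivalence ; ∙-cong = +ᶜ-cong }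
              ; assoc = +ᶜ-assoc
              }
            ; identity = comm∧idˡ⇒id +ᶜ-comm +ᶜ-identityˡ
            }
          ; inverse = comm∧invˡ⇒inv +ᶜ-comm -ᶜ-inverseˡ
          ; ⁻¹-cong = -ᶜ-cong
          }
        ; comm = +ᶜ-comm
        }
      ; *-cong = *ᶜ-cong
      ; *-assoc = *ᶜ-assoc
      ; *-identity = comm∧idˡ⇒id *ᶜ-comm *ᶜ-identityˡ
      ; distrib = comm∧distrˡ⇒distr +ᶜ-cong *ᶜ-comm *ᶜ-distribˡ-+ᶜ
      }
    ; *-comm = *ᶜ-comm
    }
  }
  where open AlgebraConsequences ℂ-setoid using (comm∧idˡ⇒id; comm∧invˡ⇒inv; comm∧distrˡ⇒distr)

open CommutativeRing ℂ-commutativeRing public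
  using (0#; 1#; _≈_; _≉_; _+_; _*_; -_)
  renaming (semiring to ℂ-semiring)

open RawSemiringDefinitions (Semiring.rawSemiring ℂ-semiring) public using (_^_)

∑ : List ℂ → ℂ
∑ = foldr _+_ 0#

∏ : List ℂ → ℂ
∏ = foldr _*_ 1#

infix 5 sumOver

sumOver : {A : Set} → List A → (A → ℂ) → ℂ
sumOver is f = ∑ (map f is)

syntax sumOver is (λ i → t) = ∑[ i ∈ is ] t

tuples : ∀ r (m : ℕ) → List (List (Fin r))
tuples r zero    = [] ∷ []
tuples r (suc m) = cartesianProductWith _∷_ (allFin r) (tuples r m)

-- For m = 0 only the empty sequence occurs, so the value is 1; for
-- m > r no sequence is strictly increasing, so the value is 0.
𝓔 : ℕ → List ℂ → ℂ
𝓔 m A = ∑[ js ∈ filter (linked? Fin._<?_) (tuples (length A) m) ] ∏ (map (lookup A) js)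

𝓗 : ℕ → List ℂ → ℂ
𝓗 m A = ∑[ js ∈ filter (linked? Fin._≤?_) (tuples (length A) m) ] ∏ (map (lookup A) js)

IsPrimitiveRoot : ℕ → ℂ → Set
IsPrimitiveRoot n z = z ^ n ≈ 1# × (∀ k → 0 ℕ.< k → k ℕ.< n → z ^ k ≉ 1#)

-- A listing A = {z₁, …, zᵣ}, r ≥ 1, of the set of primitive n-th roots
-- of unity; distinctness makes length A the cardinality of the set.
record Lists𝓩* (n : ℕ) (A : List ℂ) : Set where
  open SetoidMembership ℂ-setoid using (_∈_)
  open SetoidUnique ℂ-setoid using (Unique)
  field
    nonempty : 0 ℕ.< length A
    distinct : Unique A
    sound    : ∀ z → z ∈ A → IsPrimitiveRoot n z
    complete : ∀ z → IsPrimitiveRoot n z → z ∈ A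

𝟏[_,_] : ℤ → ℤ → ℤ → ℤ
𝟏[ a , b ] x = if does ((a ℤ.≤? x) ×-dec (x ℤ.≤? b)) then 1ℤ else 0ℤ

𝟏P : ℕ → ℤ → ℤ
𝟏P p = 𝟏[ 0ℤ , + p ℤ.- 1ℤ ]

SolvesMod : (p₁ p₂ : ℕ) → (a b : ℤ) → Set
SolvesMod p₁ p₂ a b =
  0ℤ ℤ.≤ b × b ℤ.≤ + p₁ ℤ.- 1ℤ × + p₁ ℤ.∣ (+ p₂ ℤ.* b ℤ.- a)

Δ : (p₂ : ℕ) .{{_ : ℕ.NonZero p₂}} (b₀ b₁ : ℤ → ℤ) → ℤ → ℤ
Δ p₂ b₀ b₁ j = 𝟏[ 0ℤ , j ℤ./ℕ p₂ ] (b₀ j) ℤ.- 𝟏[ 0ℤ , j ℤ./ℕ p₂ ] (b₁ j)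

-- The integers j in [0, ⌊m/p₃⌋] with j ≥ m/p₃ - (p₁-1)(p₂-1)/p₃.
I : (m p₁ p₂ p₃ : ℕ) .{{_ : ℕ.NonZero p₃}} → List ℕ
I m p₁ p₂ p₃ =
  filter (λ j → (+ m ℚ./ p₃) ℚ.- (((+ p₁ ℤ.- 1ℤ) ℤ.* (+ p₂ ℤ.- 1ℤ)) ℚ./ p₃) ℚ.≤? (+ j ℚ./ 1))
         (upTo (suc (m ℕ./ p₃)))

{-# OPTIONS --safe #-}
module Submission where

-- Write E_n(x) = ∏ (1 - zx) over the primitive n-th roots of unity z; its
-- coefficients are (-1)ᵐ 𝓔ₘ and those of H_n = 1 / E_n are 𝓗ₘ. If q is a prime
-- not dividing n, then z ↦ z^q maps the primitive roots of orders n and nq to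
-- those of order n, so the inverses of all of them are roots of E_n(x^q); a
-- count shows that there are no others, whence E_nq(x) E_n(x) = E_n(x^q). The
-- cases n = 1, p₁ and p₁p₂ give E_nq = E_n(x^q) H_n and H_nq = E_n H_n(x^q), and
-- the identities are read off coefficientwise. For the second one,
-- E_{p₁} = 1 + x + ⋯ + x^(p₁-1) and H_{p₁} = (1 - x) / (1 - x^p₁), so that the
-- coefficient of xᵐ in E_{p₁p₂} counts the j ≤ m/p₂ with p₂j ≡ m minus those
-- with p₂j ≡ m - 1 (mod p₁).

open import Algebra.Bundles using (CommutativeRing)
import Algebra.Properties.AbelianGroup as AbelianGroupProperties
import Algebra.Properties.CommutativeSemigroup as CommutativeSemigroupProperties
import Algebra.Properties.CommutativeSemiring.Exp as CommutativeExp
import Algebra.Properties.Ring as RingProperties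
import Algebra.Properties.Semiring.Exp as Exp
import Algebra.Solver.Ring.NaturalCoefficients.Default as SemiringSolver
open import Data.Bool.Base using (Bool; true; false; if_then_else_)
open import Data.Fin.Base as Fin using (Fin; zero; suc; toℕ; remQuot; combine)
import Data.Fin.Properties as Fin
open import Data.Integer.Base as ℤ using (ℤ; +_; 0ℤ; 1ℤ)
import Data.Integer.Divisibility as ℤ
import Data.Integer.Divisibility.Signed as Signed
import Data.Integer.Properties as ℤ
import Data.Integer.Solver as ℤSolver
open import Data.List.Base as List
  using (List; []; _∷_; _++_; foldr; map; filter; length; lookup; tabulate; applyUpTo; upTo; cartesianProductWith)
import Data.List.Membership.Setoid as SetoidMembership
import Data.List.Membership.Setoid.Properties as Membership
import Data.List.Properties as List
open import Data.List.Relation.Unary.All as All using (All; []; _∷_)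
import Data.List.Relation.Unary.All.Properties as All
open import Data.List.Relation.Unary.AllPairs using ([]; _∷_)
open import Data.List.Relation.Unary.Any using (here; there; index)
open import Data.List.Relation.Unary.Linked using (linked?)
import Data.List.Relation.Unary.Unique.Setoid as SetoidUnique
import Data.List.Relation.Unary.Unique.Setoid.Properties as Unique
open import Data.Nat.Base as ℕ using (ℕ; zero; suc; NonZero; z≤n; s≤s; _∸_)
open import Data.Nat.Coprimality as Coprimality using (Coprime; coprime-divisor)
import Data.Nat.DivMod as ℕ
open import Data.Nat.Divisibility as ℕ using (_∣_; _∤_; divides)
open import Data.Nat.Primality
  using (Prime; euclidsLemma; prime⇒irreducible; prime⇒nonTrivial; prime⇒nonZero)
import Data.Nat.Properties as ℕ
open import Data.Product.Base using (_×_; _,_; ∃-syntax; proj₁; proj₂; uncurry)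
open import Data.Rational.Base as ℚ using (ℚ; 0ℚ; 1ℚ; ½; ∣_∣)
import Data.Rational.Properties as ℚ
import Data.Rational.Solver as ℚSolver
open import Data.Rational.Unnormalised.Base as ℚᵘ using (mkℚᵘ)
import Data.Rational.Unnormalised.Properties as ℚᵘ
open import Data.Sum.Base using (inj₁; inj₂; [_,_]′)
open import Function.Base using (_∘_; id)
open import Level using (0ℓ)
open import Relation.Binary.Core using (Rel)
open import Relation.Binary.Definitions as Binary using (tri<; tri≈; tri>)
open import Relation.Binary.PropositionalEquality.Core as ≡ using (_≡_; _≢_)
import Relation.Binary.Reasoning.Setoid as SetoidReasoning
open import Relation.Nullary.Decidable using (does; yes; no; dec-true; dec-false; _×-dec_)
open import Relation.Nullary.Negation using (¬_; contradiction)
open import Relation.Unary using (Pred; Decidable)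

-- Formal power series

-- No root of unity is constructed and the totient function is never evaluated in advance. The
-- number of roots of order nq is trapped between two bounds. Products of roots of order n with
-- powers of a root of order q bound it from below; over a domain a nonzero polynomial has at most
-- as many roots as its degree, which bounds it from above. The resulting equality of lengths also
-- supplies every degree used later, including (p₁ - 1)(p₂ - 1). Equality of Cauchy reals cannot be
-- decided, so the domain property is used in the form: xy = 0 and x ≠ 0 give y = 0. The
-- distinctness of the listed roots provides the inequality.

module PowerSeries {c ℓ} (R : CommutativeRing c ℓ) where
  open CommutativeRing R
  open RingProperties ring
  open Exp semiring using (_^_)
  open AbelianGroupProperties +-abelianGroup using (⁻¹-∙-comm)
  open CommutativeSemigroupProperties +-commutativeSemigroup using (interchange)
  open SemiringSolver commutativeSemiring using (solve; _:=_; _:+_; _:*_)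
  open SetoidReasoning setoid
  open SetoidUnique setoid using (Unique)
  open SetoidMembership setoid using (_∈_)

  infix  4 _≋_
  infixl 7 _⊛_

  Series : Set c
  Series = ℕ → Carrier

  _≋_ : Series → Series → Set ℓ
  f ≋ g = ∀ n → f n ≈ g n

  tail : Series → Series
  tail f n = f (suc n)

  δ : Series
  δ zero    = 1#
  δ (suc _) = 0#

  -- The recursion follows f = f(0) + x · `tail f`, so proofs go by induction on the index with the
  -- left factor varying.
  _⊛_ : Series → Series → Series
  (f ⊛ g) zero    = f 0 * g 0
  (f ⊛ g) (suc n) = f 0 * g (suc n) + (tail f ⊛ g) n

  ⊛-cong : ∀ {f f′ g g′} → f ≋ f′ → g ≋ g′ → f ⊛ g ≋ f′ ⊛ g′
  ⊛-cong p q zero    = *-cong (p 0) (q 0)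
  ⊛-cong p q (suc n) = +-cong (*-cong (p 0) (q (suc n))) (⊛-cong (p ∘ suc) q n)

  -- The tail of `f ⊛ g` unfolds to `f 0` times `tail g` plus `tail f ⊛ g`; this is the linearity
  -- that associativity needs.
  ⊛-linearˡ : ∀ a f g h → (λ k → a * f k + g k) ⊛ h ≋ λ n → a * (f ⊛ h) n + (g ⊛ h) n
  ⊛-linearˡ a f g h zero    =
    solve 4 (λ a f g h → ((a :* f :+ g) :* h) := (a :* (f :* h) :+ g :* h)) refl a (f 0) (g 0) (h 0)
  ⊛-linearˡ a f g h (suc n) = trans (+-congˡ (⊛-linearˡ a (tail f) (tail g) h n))
    (solve 6 (λ a f g h x y →
        ((a :* f :+ g) :* h :+ (a :* x :+ y)) := (a :* (f :* h :+ x) :+ (g :* h :+ y)))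
      refl a (f 0) (g 0) (h (suc n)) ((tail f ⊛ h) n) ((tail g ⊛ h) n))

  ⊛-assoc : ∀ f g h → (f ⊛ g) ⊛ h ≋ f ⊛ (g ⊛ h)
  ⊛-assoc f g h zero    = *-assoc _ _ _
  ⊛-assoc f g h (suc n) = begin
    f 0 * g 0 * h (suc n) + ((λ k → f 0 * tail g k + (tail f ⊛ g) k) ⊛ h) n
      ≈⟨ +-congˡ (⊛-linearˡ (f 0) (tail g) (tail f ⊛ g) h n) ⟩
    f 0 * g 0 * h (suc n) + (f 0 * (tail g ⊛ h) n + ((tail f ⊛ g) ⊛ h) n)
      ≈⟨ +-congˡ (+-congˡ (⊛-assoc (tail f) g h n)) ⟩
    f 0 * g 0 * h (suc n) + (f 0 * (tail g ⊛ h) n + (tail f ⊛ (g ⊛ h)) n)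
      ≈⟨ solve 5 (λ a b c x y → (a :* b :* c :+ (a :* x :+ y)) := (a :* (b :* c :+ x) :+ y)) refl
           (f 0) (g 0) (h (suc n)) ((tail g ⊛ h) n) ((tail f ⊛ (g ⊛ h)) n) ⟩
    f 0 * (g ⊛ h) (suc n) + (tail f ⊛ (g ⊛ h)) n ∎

  -- The mirror image of the defining recursion, which peels only the left factor; commutativity
  -- needs both.
  ⊛-sucʳ : ∀ f g n → (f ⊛ g) (suc n) ≈ (f ⊛ tail g) n + f (suc n) * g 0
  ⊛-sucʳ f g zero    = refl
  ⊛-sucʳ f g (suc n) = trans (+-congˡ (⊛-sucʳ (tail f) g n)) (sym (+-assoc _ _ _))

  ⊛-comm : ∀ f g → f ⊛ g ≋ g ⊛ f
  ⊛-comm f g zero    = *-comm _ _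
  ⊛-comm f g (suc n) = begin
    f 0 * g (suc n) + (tail f ⊛ g) n  ≈⟨ +-cong (*-comm _ _) (⊛-comm (tail f) g n) ⟩
    g (suc n) * f 0 + (g ⊛ tail f) n  ≈⟨ +-comm _ _ ⟩
    (g ⊛ tail f) n + g (suc n) * f 0  ≈⟨ ⊛-sucʳ g f n ⟨
    (g ⊛ f) (suc n)                   ∎

  ⊛-zeroˡ : ∀ f g n → (∀ i → i ℕ.≤ n → f i ≈ 0#) → (f ⊛ g) n ≈ 0#
  ⊛-zeroˡ f g zero    f≈0 = trans (*-congʳ (f≈0 0 z≤n)) (zeroˡ _)
  ⊛-zeroˡ f g (suc n) f≈0 = begin
    f 0 * g (suc n) + (tail f ⊛ g) n
      ≈⟨ +-cong (trans (*-congʳ (f≈0 0 z≤n)) (zeroˡ _)) (⊛-zeroˡ (tail f) g n (λ i i≤n → f≈0 (suc i) (s≤s i≤n))) ⟩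
    0# + 0#  ≈⟨ +-identityʳ 0# ⟩
    0#       ∎

  ⊛-identityˡ : ∀ g → δ ⊛ g ≋ g
  ⊛-identityˡ g zero    = *-identityˡ _
  ⊛-identityˡ g (suc n) = begin
    _                ≈⟨ +-cong (*-identityˡ _) (⊛-zeroˡ (tail δ) g n (λ _ _ → refl)) ⟩
    g (suc n) + 0#   ≈⟨ +-identityʳ _ ⟩
    g (suc n)        ∎

  -- The products (1 - zx) f and f / (1 - zx).
  times over : Carrier → Series → Series
  times z f zero    = f 0
  times z f (suc n) = f (suc n) + - z * f n
  over z f zero    = f 0
  over z f (suc n) = f (suc n) + z * over z f n

  times-cong : ∀ {z z′ f f′} → z ≈ z′ → f ≋ f′ → times z f ≋ times z′ f′
  times-cong r p zero    = p 0
  times-cong r p (suc n) = +-cong (p (suc n)) (*-cong (-‿cong r) (p n))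

  over-cong : ∀ {z z′ f f′} → z ≈ z′ → f ≋ f′ → over z f ≋ over z′ f′
  over-cong r p zero    = p 0
  over-cong r p (suc n) = +-cong (p (suc n)) (*-cong r (over-cong r p n))

  times-over : ∀ z f → times z (over z f) ≋ f
  times-over z f zero    = refl
  times-over z f (suc n) = trans (+-congˡ (sym (-‿distribˡ-* z (over z f n))))
    (//-rightDividesʳ (z * over z f n) (f (suc n)))

  over-times : ∀ z f → over z (times z f) ≋ f
  over-times z f zero    = refl
  over-times z f (suc n) = trans (+-cong (+-congˡ (sym (-‿distribˡ-* z (f n)))) (*-congˡ (over-times z f n)))
    (//-rightDividesˡ (z * f n) (f (suc n)))

  -- Both operators are multiplications by power series. For f of degree at most n, the right side
  -- at n + 1 is w - z times the reversed value of f at n, which is how factors are split off below.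
  over-times-comm : ∀ w z f → over w (times z f) ≋ times z (over w f)
  over-times-comm w z f zero          = refl
  over-times-comm w z f (suc zero)    =
    solve 4 (λ a b w z → ((a :+ z :* b) :+ w :* b) := ((a :+ w :* b) :+ z :* b)) refl
      (f 1) (f 0) w (- z)
  over-times-comm w z f (suc (suc n)) =
    trans (+-congˡ (*-congˡ (over-times-comm w z f (suc n))))
    (solve 6 (λ a b w z x y →
        ((a :+ z :* b) :+ w :* (x :+ z :* y)) := ((a :+ w :* x) :+ z :* (b :+ w :* y)))
      refl (f (suc (suc n))) (f (suc n)) w (- z) (over w f (suc n)) (over w f n))

  times-⊛ : ∀ z f g → times z f ⊛ g ≋ times z (f ⊛ g)
  times-⊛ z f g zero    = refl
  times-⊛ z f g (suc n) = begin
    f 0 * g (suc n) + ((λ k → f (suc k) + - z * f k) ⊛ g) n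
      ≈⟨ +-congˡ (⊛-cong (λ k → +-comm _ _) (λ _ → refl) n) ⟩
    f 0 * g (suc n) + ((λ k → - z * f k + tail f k) ⊛ g) n
      ≈⟨ +-congˡ (⊛-linearˡ (- z) f (tail f) g n) ⟩
    f 0 * g (suc n) + (- z * (f ⊛ g) n + (tail f ⊛ g) n)
      ≈⟨ solve 4 (λ a z x y → (a :+ (z :* x :+ y)) := ((a :+ y) :+ z :* x)) refl
           (f 0 * g (suc n)) (- z) ((f ⊛ g) n) ((tail f ⊛ g) n) ⟩
    (f ⊛ g) (suc n) + - z * (f ⊛ g) n ∎

  -- ∏ (1 - zx) and its reciprocal, the generating functions of (-1)ᵐ 𝓔ₘ and 𝓗ₘ.
  eSeries hSeries : List Carrier → Series
  eSeries = foldr times δ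
  hSeries = foldr over δ

  eSeries-++ : ∀ A B → eSeries (A ++ B) ≋ eSeries A ⊛ eSeries B
  eSeries-++ []      B n = sym (⊛-identityˡ (eSeries B) n)
  eSeries-++ (z ∷ A) B n = trans (times-cong refl (eSeries-++ A B) n)
    (sym (times-⊛ z (eSeries A) (eSeries B) n))

  hSeries-⊛-eSeries : ∀ A → hSeries A ⊛ eSeries A ≋ δ
  hSeries-⊛-eSeries []      n = ⊛-identityˡ δ n
  hSeries-⊛-eSeries (z ∷ A) n = begin
    (over z H ⊛ times z E) n   ≈⟨ ⊛-comm (over z H) (times z E) n ⟩
    (times z E ⊛ over z H) n   ≈⟨ times-⊛ z E (over z H) n ⟩
    times z (E ⊛ over z H) n   ≈⟨ times-cong refl (⊛-comm E (over z H)) n ⟩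
    times z (over z H ⊛ E) n   ≈⟨ times-⊛ z (over z H) E n ⟨
    (times z (over z H) ⊛ E) n ≈⟨ ⊛-cong (times-over z H) (λ _ → refl) n ⟩
    (H ⊛ E) n                  ≈⟨ hSeries-⊛-eSeries A n ⟩
    δ n                        ∎
    where H = hSeries A
          E = eSeries A

  eSeries-zero : ∀ A → eSeries A 0 ≈ 1#
  eSeries-zero []      = refl
  eSeries-zero (z ∷ A) = eSeries-zero A

  x+z*y≈0 : ∀ {x y} z → x ≈ 0# → y ≈ 0# → x + z * y ≈ 0#
  x+z*y≈0 z p q = trans (+-cong p (trans (*-congˡ q) (zeroʳ z))) (+-identityˡ 0#)

  eSeries-vanishes : ∀ A n → length A ℕ.< n → eSeries A n ≈ 0#
  eSeries-vanishes []      (suc n) _       = refl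
  eSeries-vanishes (z ∷ A) (suc n) (s≤s p) =
    x+z*y≈0 (- z) (eSeries-vanishes A (suc n) (ℕ.m≤n⇒m≤1+n p)) (eSeries-vanishes A n p)

  -- For f of degree at most d, the coefficient (over w f) d is the value
  -- wᵈ f(1/w) of the reversed polynomial.
  eSeries-root : ∀ {w} A → w ∈ A → over w (eSeries A) (length A) ≈ 0#
  eSeries-root {w} (z ∷ A) (here w≈z) = begin
    over w (times z E) (suc (length A))  ≈⟨ over-cong w≈z (λ _ → refl) (suc (length A)) ⟩
    over z (times z E) (suc (length A))  ≈⟨ over-times z E (suc (length A)) ⟩
    E (suc (length A))                   ≈⟨ eSeries-vanishes A _ ℕ.≤-refl ⟩
    0#                                   ∎
    where E = eSeries A
  eSeries-root {w} (z ∷ A) (there w∈A) = begin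
    over w (times z E) (suc (length A))  ≈⟨ over-times-comm w z E (suc (length A)) ⟩
    over w E (suc (length A)) + - z * over w E (length A)
      ≈⟨ x+z*y≈0 (- z) (x+z*y≈0 w (eSeries-vanishes A _ ℕ.≤-refl) root) root ⟩
    0# ∎
    where E = eSeries A
          root = eSeries-root A w∈A

  -- Polynomials determined by their roots

  module _ (domain : ∀ {x y} → x * y ≈ 0# → ¬ x ≈ 0# → y ≈ 0#) (1≉0 : ¬ 1# ≈ 0#) where

    -- The factor theorem, iterated: `over w f` divides by 1 - wx, the root condition makes the
    -- quotient a polynomial of degree one less, and the other roots pass to it. Only d ≤ `length L`
    -- is assumed; equality is part of the conclusion.
    eSeries-unique : ∀ d f L → f 0 ≈ 1# → (∀ n → d ℕ.< n → f n ≈ 0#) → Unique L →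
      All (λ w → over w f d ≈ 0#) L → d ℕ.≤ length L → length L ≡ d × f ≋ eSeries L
    eSeries-unique zero f [] f₀ f₊ _ _ _ = ≡.refl , λ where
      zero    → f₀
      (suc n) → f₊ (suc n) (s≤s z≤n)
    -- A constant equal to 1 has no root, so the list cannot be longer than the degree.
    eSeries-unique zero f (w ∷ L) f₀ f₊ _ (f₀≈0 ∷ _) _ = contradiction (trans (sym f₀) f₀≈0) 1≉0
    eSeries-unique (suc d) f (w ∷ L) f₀ f₊ (w∉L ∷ uniq) (root ∷ roots) (s≤s d≤) =
      ≡.cong suc (proj₁ rec) , λ n → begin
        f n                 ≈⟨ times-over w f n ⟨
        times w (over w f) n ≈⟨ times-cong refl (proj₂ rec) n ⟩
        times w (eSeries L) n ∎
      where
      g : Series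
      g = over w f
      -- The root condition is the vanishing of `g` at d + 1; from there the recursion of `over`
      -- propagates zero, as f has degree at most d + 1.
      g₊ : ∀ n → d ℕ.< n → g n ≈ 0#
      g₊ (suc n) (s≤s d≤n) with ℕ.m≤n⇒m<n∨m≡n d≤n
      ... | inj₁ d<n = x+z*y≈0 w (f₊ (suc n) (s≤s d<n)) (g₊ n d<n)
      ... | inj₂ ≡.refl = root
      g-root : ∀ {w′} → ¬ w ≈ w′ → over w′ f (suc d) ≈ 0# → over w′ g d ≈ 0#
      g-root {w′} w≉w′ r = domain (begin
        (w′ - w) * over w′ g d                    ≈⟨ distribʳ _ _ _ ⟩
        w′ * over w′ g d + - w * over w′ g d
          ≈⟨ +-congʳ (trans (+-congʳ (g₊ (suc d) ℕ.≤-refl)) (+-identityˡ _)) ⟨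
        over w′ g (suc d) + - w * over w′ g d     ≈⟨ over-times-comm w′ w g (suc d) ⟨
        over w′ (times w g) (suc d)               ≈⟨ over-cong refl (times-over w f) (suc d) ⟩
        over w′ f (suc d)                         ≈⟨ r ⟩
        0#                                        ∎)
        (λ w′-w≈0 → w≉w′ (sym (x∙y⁻¹≈ε⇒x≈y w′ w w′-w≈0)))
      rec : length L ≡ d × g ≋ eSeries L
      rec = eSeries-unique d g L f₀ g₊ uniq (All.zipWith (λ (p , q) → g-root p q) (w∉L , roots)) d≤

  ≋-refl : ∀ {f} → f ≋ f
  ≋-refl _ = refl

  ⊛-identityʳ : ∀ g → g ⊛ δ ≋ g
  ⊛-identityʳ g n = trans (⊛-comm g δ n) (⊛-identityˡ g n)

  eSeries-⊛-hSeries : ∀ A → eSeries A ⊛ hSeries A ≋ δ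
  eSeries-⊛-hSeries A n = trans (⊛-comm (eSeries A) (hSeries A) n) (hSeries-⊛-eSeries A n)

  hSeries-unique : ∀ f A → f ⊛ eSeries A ≋ δ → f ≋ hSeries A
  hSeries-unique f A f⊛e n = begin
    f n                              ≈⟨ ⊛-identityʳ f n ⟨
    (f ⊛ δ) n                        ≈⟨ ⊛-cong {f} ≋-refl (eSeries-⊛-hSeries A) n ⟨
    (f ⊛ (eSeries A ⊛ hSeries A)) n  ≈⟨ ⊛-assoc f (eSeries A) (hSeries A) n ⟨
    (f ⊛ eSeries A ⊛ hSeries A) n    ≈⟨ ⊛-cong {g = hSeries A} f⊛e ≋-refl n ⟩
    (δ ⊛ hSeries A) n                ≈⟨ ⊛-identityˡ (hSeries A) n ⟩
    hSeries A n                      ∎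

  -- Finite sums and the substitution of x^q for x

  ∑< : ℕ → (ℕ → Carrier) → Carrier
  ∑< n F = foldr _+_ 0# (applyUpTo F n)

  -- Applied to a remainder modulo q, it selects the exponents divisible by q.
  at : ℕ → Carrier → Carrier
  at zero    x = x
  at (suc _) x = 0#

  at-cong : ∀ n {x y} → x ≈ y → at n x ≈ at n y
  at-cong zero    p = p
  at-cong (suc _) p = refl

  at-linear : ∀ n a x y → at n (a * x + y) ≈ a * at n x + at n y
  at-linear zero    a x y = refl
  at-linear (suc _) a x y = sym (trans (+-identityʳ _) (zeroʳ a))

  module _ (q : ℕ) .{{_ : NonZero q}} where

    -- The series f(x^q).
    dilate : Series → Series
    dilate f n = at (n ℕ.% q) (f (n ℕ./ q))

    dilate-cong : ∀ {f g} → f ≋ g → dilate f ≋ dilate g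
    dilate-cong p n = at-cong (n ℕ.% q) (p (n ℕ./ q))

    [q+n]%q≡n%q : ∀ n → (q ℕ.+ n) ℕ.% q ≡ n ℕ.% q
    [q+n]%q≡n%q n = ≡.trans (ℕ.%-congˡ (ℕ.+-comm q n)) (ℕ.[m+n]%n≡m%n n q)

    [q+n]/q≡1+n/q : ∀ n → (q ℕ.+ n) ℕ./ q ≡ suc (n ℕ./ q)
    [q+n]/q≡1+n/q n = ≡.trans (ℕ.+-distrib-/-∣ˡ n ℕ.∣-refl) (≡.cong (ℕ._+ n ℕ./ q) (ℕ.n/n≡1 q))

    -- Induction on the quotient n / q. It suits f(x^q), where advancing q places replaces f by its
    -- tail.
    mod-induction : ∀ {a} (P : ℕ → Set a) →
      (∀ r → r ℕ.< q → P r) → (∀ n → P n → P (q ℕ.+ n)) → ∀ n → P n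
    mod-induction P base step n = ≡.subst P (≡.sym (ℕ.m≡m%n+[m/n]*n n q)) (go (n ℕ./ q))
      where
      r = n ℕ.% q
      go : ∀ k → P (r ℕ.+ k ℕ.* q)
      go zero    = ≡.subst P (≡.sym (ℕ.+-identityʳ r)) (base r (ℕ.m%n<n n q))
      go (suc k) = ≡.subst P (x∙yz≈y∙xz q r (k ℕ.* q)) (step _ (go k))
        where open CommutativeSemigroupProperties ℕ.+-commutativeSemigroup using (x∙yz≈y∙xz)

    dilate-< : ∀ f {r} → r ℕ.< q → dilate f r ≈ at r (f 0)
    dilate-< f r<q = reflexive (≡.cong₂ (λ r k → at r (f k)) (ℕ.m<n⇒m%n≡m r<q) (ℕ.m<n⇒m/n≡0 r<q))

    dilate-zero : ∀ f → dilate f 0 ≈ f 0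
    dilate-zero f = dilate-< f (ℕ.>-nonZero⁻¹ q)

    dilate-q+ : ∀ f n → dilate f (q ℕ.+ n) ≈ dilate (tail f) n
    dilate-q+ f n = reflexive (≡.cong₂ (λ r k → at r (f k)) ([q+n]%q≡n%q n) ([q+n]/q≡1+n/q n))

    dilate-vanishes : ∀ f d → (∀ n → d ℕ.< n → f n ≈ 0#) → ∀ n → q ℕ.* d ℕ.< n → dilate f n ≈ 0#
    dilate-vanishes f d f₊ n qd<n with n ℕ.% q in eq
    ... | suc _ = refl
    ... | zero  = f₊ (n ℕ./ q) (ℕ.*-cancelˡ-< q d (n ℕ./ q) (≡.subst (q ℕ.* d ℕ.<_) n≡q*[n/q] qd<n))
      where
      n≡q*[n/q] : n ≡ q ℕ.* (n ℕ./ q)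
      n≡q*[n/q] = ≡.trans (ℕ.m≡m%n+[m/n]*n n q) 
        (≡.trans (≡.cong (ℕ._+ n ℕ./ q ℕ.* q) eq) (ℕ.*-comm (n ℕ./ q) q))

    dilate-δ : dilate δ ≋ δ
    dilate-δ = mod-induction _
      (λ { zero r<q → dilate-zero δ ; (suc r) r<q → dilate-< δ r<q })
      (λ n _ → trans (dilate-q+ δ n) (trans (at-0 (n ℕ.% q)) (sym (δ-+ q n))))
      where
      at-0 : ∀ n → at n 0# ≈ 0#
      at-0 zero    = refl
      at-0 (suc _) = refl
      δ-+ : ∀ q .{{_ : NonZero q}} n → δ (q ℕ.+ n) ≈ 0#
      δ-+ (suc _) n = refl

    dilate-⊛-< : ∀ f g {r} → r ℕ.< q → (dilate f ⊛ g) r ≈ f 0 * g r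
    dilate-⊛-< f g {r} r<q = begin
      (dilate f ⊛ g) r  ≈⟨ low (dilate f) g r (λ i i<r → dilate-< f (ℕ.≤-<-trans i<r r<q)) ⟩
      dilate f 0 * g r  ≈⟨ *-congʳ (dilate-zero f) ⟩
      f 0 * g r         ∎
      where
      low : ∀ f g r → (∀ i → i ℕ.< r → f (suc i) ≈ 0#) → (f ⊛ g) r ≈ f 0 * g r
      low f g zero    f≈0 = refl
      low f g (suc r) f≈0 = trans (+-congˡ (⊛-zeroˡ (tail f) g r (λ i i≤r → f≈0 i (s≤s i≤r)))) (+-identityʳ _)

  ⊛-skip : ∀ k f g n → (∀ i → i ℕ.< k → f i ≈ 0#) → (f ⊛ g) (k ℕ.+ n) ≈ ((λ i → f (k ℕ.+ i)) ⊛ g) n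
  ⊛-skip zero    f g n f≈0 = refl
  ⊛-skip (suc k) f g n f≈0 = begin
    _  ≈⟨ +-cong (trans (*-congʳ (f≈0 0 (s≤s z≤n))) (zeroˡ _))
            (⊛-skip k (tail f) g n (λ i i<k → f≈0 (suc i) (s≤s i<k))) ⟩
    _  ≈⟨ +-identityˡ _ ⟩
    _  ∎

  -- The recursion of `⊛` in blocks of q: the constant term takes one step, and the q - 1 zero
  -- coefficients before x^q are skipped.
  dilate-⊛-q+ : ∀ q .{{_ : NonZero q}} f g n →
    (dilate q f ⊛ g) (q ℕ.+ n) ≈ f 0 * g (q ℕ.+ n) + (dilate q (tail f) ⊛ g) n
  dilate-⊛-q+ q@(suc p) f g n = +-cong (*-congʳ (dilate-zero q f)) (begin
    (tail (dilate q f) ⊛ g) (p ℕ.+ n)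
      ≈⟨ ⊛-skip p (tail (dilate q f)) g n (λ i i<p → dilate-< q f (s≤s i<p)) ⟩
    ((λ i → dilate q f (q ℕ.+ i)) ⊛ g) n
      ≈⟨ ⊛-cong (dilate-q+ q f) ≋-refl n ⟩
    (dilate q (tail f) ⊛ g) n ∎)

  dilate-⊛ : ∀ q .{{_ : NonZero q}} f g → dilate q f ⊛ dilate q g ≋ dilate q (f ⊛ g)
  -- `f` is quantified inside the predicate because the inductive step moves to `tail f`.
  dilate-⊛ q f g n = mod-induction q (λ n → ∀ f → (dilate q f ⊛ dilate q g) n ≈ dilate q (f ⊛ g) n)
    (λ r r<q f → begin
      (dilate q f ⊛ dilate q g) r  ≈⟨ dilate-⊛-< q f (dilate q g) r<q ⟩
      f 0 * dilate q g r           ≈⟨ *-congˡ (dilate-< q g r<q) ⟩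
      f 0 * at r (g 0)             ≈⟨ at-* r (f 0) (g 0) ⟩
      at r (f 0 * g 0)             ≈⟨ dilate-< q (f ⊛ g) r<q ⟨
      dilate q (f ⊛ g) r           ∎)
    (λ n rec f → begin
      (dilate q f ⊛ dilate q g) (q ℕ.+ n)
        ≈⟨ dilate-⊛-q+ q f (dilate q g) n ⟩
      f 0 * dilate q g (q ℕ.+ n) + (dilate q (tail f) ⊛ dilate q g) n
        ≈⟨ +-cong (*-congˡ (dilate-q+ q g n)) (rec (tail f)) ⟩
      f 0 * dilate q (tail g) n + dilate q (tail f ⊛ g) n
        ≈⟨ at-linear (n ℕ.% q) _ _ _ ⟨
      dilate q (tail (f ⊛ g)) n
        ≈⟨ dilate-q+ q (f ⊛ g) n ⟨
      dilate q (f ⊛ g) (q ℕ.+ n) ∎)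
    n f
    where
    at-* : ∀ n a x → a * at n x ≈ at n (a * x)
    at-* zero    a x = refl
    at-* (suc _) a x = zeroʳ a

  ∑<-cong : ∀ n {F G : ℕ → Carrier} → (∀ i → i ℕ.< n → F i ≈ G i) → ∑< n F ≈ ∑< n G
  ∑<-cong zero    p = refl
  ∑<-cong (suc n) p = +-cong (p 0 (s≤s z≤n)) (∑<-cong n (λ i i<n → p (suc i) (s≤s i<n)))

  ∑<-zero : ∀ n {F : ℕ → Carrier} → (∀ i → i ℕ.< n → F i ≈ 0#) → ∑< n F ≈ 0#
  ∑<-zero zero    p = refl
  ∑<-zero (suc n) p = trans (+-cong (p 0 (s≤s z≤n)) (∑<-zero n (λ i i<n → p (suc i) (s≤s i<n)))) (+-identityʳ 0#)

  ∑<-single : ∀ n {F : ℕ → Carrier} i → i ℕ.< n → (∀ j → j ℕ.< n → j ≢ i → F j ≈ 0#) → ∑< n F ≈ F i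
  ∑<-single (suc n) zero    _         p = trans
    (+-congˡ (∑<-zero n (λ j j<n → p (suc j) (s≤s j<n) λ ()))) (+-identityʳ _)
  ∑<-single (suc n) (suc i) (s≤s i<n) p = trans
    (+-cong (p 0 (s≤s z≤n) λ ()) (∑<-single n i i<n (λ j j<n j≢i → p (suc j) (s≤s j<n) (j≢i ∘ ℕ.suc-injective))))
    (+-identityˡ _)

  ∑<-distrib-minus : ∀ n (F G : ℕ → Carrier) → ∑< n (λ i → F i - G i) ≈ ∑< n F - ∑< n G
  ∑<-distrib-minus zero    F G = sym (-‿inverseʳ 0#)
  ∑<-distrib-minus (suc n) F G = begin
    (F 0 - G 0) + ∑< n (λ i → F (suc i) - G (suc i))        ≈⟨ +-congˡ (∑<-distrib-minus n (F ∘ suc) (G ∘ suc)) ⟩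
    (F 0 - G 0) + (∑< n (F ∘ suc) - ∑< n (G ∘ suc))         ≈⟨ interchange _ _ _ _ ⟩
    (F 0 + ∑< n (F ∘ suc)) + (- G 0 - ∑< n (G ∘ suc))       ≈⟨ +-congˡ (⁻¹-∙-comm (G 0) _) ⟩
    ∑< (suc n) F - ∑< (suc n) G                             ∎

  -- Turns the recursive product into the explicit sums of the identities. Each j is at most n / q,
  -- so the subtraction never truncates.
  dilate-⊛-sum : ∀ q .{{_ : NonZero q}} f g n →
    (dilate q f ⊛ g) n ≈ ∑< (suc (n ℕ./ q)) (λ j → f j * g (n ∸ j ℕ.* q))
  dilate-⊛-sum q f g n = mod-induction q
    (λ n → ∀ f → (dilate q f ⊛ g) n ≈ ∑< (suc (n ℕ./ q)) (λ j → f j * g (n ∸ j ℕ.* q)))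
    (λ r r<q f → let F = λ j → f j * g (r ∸ j ℕ.* q) in begin
      (dilate q f ⊛ g) r    ≈⟨ dilate-⊛-< q f g r<q ⟩
      f 0 * g r             ≈⟨ +-identityʳ _ ⟨
      ∑< 1 F                ≡⟨ ≡.cong (λ k → ∑< (suc k) F) (ℕ.m<n⇒m/n≡0 r<q) ⟨
      ∑< (suc (r ℕ./ q)) F  ∎)
    (λ n rec f → let F = λ j → f j * g (q ℕ.+ n ∸ j ℕ.* q) in begin
      (dilate q f ⊛ g) (q ℕ.+ n)
        ≈⟨ dilate-⊛-q+ q f g n ⟩
      F 0 + (dilate q (tail f) ⊛ g) n
        ≈⟨ +-congˡ (rec (tail f)) ⟩
      F 0 + ∑< (suc (n ℕ./ q)) (λ j → f (suc j) * g (n ∸ j ℕ.* q))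
        ≈⟨ +-congˡ (∑<-cong (suc (n ℕ./ q)) (λ j _ → *-congˡ {f (suc j)}
             (reflexive (≡.cong g (≡.sym (ℕ.[m+n]∸[m+o]≡n∸o q n (j ℕ.* q))))))) ⟩
      ∑< (suc (suc (n ℕ./ q))) F
        ≡⟨ ≡.cong (λ k → ∑< (suc k) F) ([q+n]/q≡1+n/q q n) ⟨
      ∑< (suc ((q ℕ.+ n) ℕ./ q)) F ∎)
    n f

  over-skip : ∀ w f k n → (∀ i → i ℕ.< k → f (suc (i ℕ.+ n)) ≈ 0#) →
    over w f (k ℕ.+ n) ≈ w ^ k * over w f n
  over-skip w f zero    n f≈0 = sym (*-identityˡ _)
  over-skip w f (suc k) n f≈0 = begin
    f (suc (k ℕ.+ n)) + w * over w f (k ℕ.+ n)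
      ≈⟨ +-cong (f≈0 k ℕ.≤-refl) (*-congˡ (over-skip w f k n (λ i i<k → f≈0 i (ℕ.m≤n⇒m≤1+n i<k)))) ⟩
    0# + w * (w ^ k * over w f n)
      ≈⟨ +-identityˡ _ ⟩
    w * (w ^ k * over w f n)
      ≈⟨ *-assoc _ _ _ ⟨
    w ^ suc k * over w f n ∎

  -- In terms of reversed values, both sides are w^(qk) f(w^(-q)) when f has degree at most k. Hence
  -- roots of f(x^q) are detected by their q-th powers.
  over-dilate : ∀ q .{{_ : NonZero q}} w f k → over w (dilate q f) (q ℕ.* k) ≈ over (w ^ q) f k
  over-dilate q w f k = trans (reflexive (≡.cong (over w (dilate q f)) (ℕ.*-comm q k))) (go q k)
    where
    dilate-r+k*q : ∀ q .{{_ : NonZero q}} {r} k → r ℕ.< q → dilate q f (r ℕ.+ k ℕ.* q) ≈ at r (f k)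
    dilate-r+k*q q {r} k r<q = reflexive (≡.cong₂ (λ r k → at r (f k))
      (≡.trans (ℕ.[m+kn]%n≡m%n r k q) (ℕ.m<n⇒m%n≡m r<q))
      (≡.trans (ℕ.+-distrib-/-∣ʳ r (ℕ.n∣m*n k)) (≡.cong₂ ℕ._+_ (ℕ.m<n⇒m/n≡0 r<q) (ℕ.m*n/n≡m k q))))
    go : ∀ q .{{_ : NonZero q}} k → over w (dilate q f) (k ℕ.* q) ≈ over (w ^ q) f k
    go q         zero    = dilate-zero q f
    go q@(suc p) (suc k) = begin
      -- The q - 1 zero coefficients between consecutive multiples of q contribute `w ^ p`; the step
      -- onto the next multiple gives the last factor w.
      dilate q f (q ℕ.+ k ℕ.* q) + w * over w (dilate q f) (p ℕ.+ k ℕ.* q)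
        ≈⟨ +-cong (dilate-r+k*q q (suc k) (s≤s z≤n))
             (*-congˡ (over-skip w (dilate q f) p (k ℕ.* q) (λ i i<p → dilate-r+k*q q k (s≤s i<p)))) ⟩
      f (suc k) + w * (w ^ p * over w (dilate q f) (k ℕ.* q))
        ≈⟨ +-congˡ (*-assoc _ _ _) ⟨
      f (suc k) + w ^ q * over w (dilate q f) (k ℕ.* q)
        ≈⟨ +-congˡ (*-congˡ (go q k)) ⟩
      f (suc k) + w ^ q * over (w ^ q) f k ∎

  -- Quotients of generating functions

  module _ {q : ℕ} .{{_ : NonZero q}} {A B : List Carrier} (e : eSeries (B ++ A) ≋ dilate q (eSeries A)) where

    private
      EA = eSeries A
      EB = eSeries B
      HA = hSeries A

      EB⊛EA : EB ⊛ EA ≋ dilate q EA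
      EB⊛EA n = trans (sym (eSeries-++ B A n)) (e n)

    eSeries-quotient : eSeries B ≋ dilate q (eSeries A) ⊛ hSeries A
    eSeries-quotient n = begin
      EB n                  ≈⟨ ⊛-identityʳ EB n ⟨
      (EB ⊛ δ) n            ≈⟨ ⊛-cong {EB} ≋-refl (eSeries-⊛-hSeries A) n ⟨
      (EB ⊛ (EA ⊛ HA)) n    ≈⟨ ⊛-assoc EB EA HA n ⟨
      (EB ⊛ EA ⊛ HA) n      ≈⟨ ⊛-cong {g = HA} EB⊛EA ≋-refl n ⟩
      (dilate q EA ⊛ HA) n  ∎

    -- A reciprocal is unique, so it suffices to multiply by `EB`. Substituting x^q respects
    -- products, hence sends `HA ⊛ EA`, which is 1, to 1.
    hSeries-quotient : hSeries B ≋ dilate q (hSeries A) ⊛ eSeries A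
    hSeries-quotient n = sym (hSeries-unique (dilate q HA ⊛ EA) B (λ n → begin
      (dilate q HA ⊛ EA ⊛ EB) n    ≈⟨ ⊛-assoc (dilate q HA) EA EB n ⟩
      (dilate q HA ⊛ (EA ⊛ EB)) n  ≈⟨ ⊛-cong {dilate q HA} ≋-refl (λ n → trans (⊛-comm EA EB n) (EB⊛EA n)) n ⟩
      (dilate q HA ⊛ dilate q EA) n ≈⟨ dilate-⊛ q HA EA n ⟩
      dilate q (HA ⊛ EA) n         ≈⟨ dilate-cong q (hSeries-⊛-eSeries A) n ⟩
      dilate q δ n                 ≈⟨ dilate-δ q n ⟩
      δ n                          ∎) n)

open import Defs

-- Elementary arithmetic

prime∤⇒coprime : ∀ {n q} → Prime q → q ∤ n → Coprime n q
prime∤⇒coprime {n} q-prime q∤n (d∣n , d∣q) with prime⇒irreducible q-prime d∣q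
... | inj₁ d≡1 = d≡1
... | inj₂ d≡q = contradiction (≡.subst (_∣ n) d≡q d∣n) q∤n

<⇒∤ : ∀ {m n} .{{_ : NonZero m}} → m ℕ.< n → n ∤ m
<⇒∤ m<n n∣m = ℕ.<⇒≱ m<n (ℕ.∣⇒≤ n∣m)

<-∣⇒≡0 : ∀ {m n} → m ℕ.< n → n ∣ m → m ≡ 0
<-∣⇒≡0 {zero}  _   _   = ≡.refl
<-∣⇒≡0 {suc m} m<n n∣m = contradiction n∣m (<⇒∤ m<n)

prime⇒1< : ∀ {p} → Prime p → 1 ℕ.< p
prime⇒1< p-prime = ℕ.nonTrivial⇒n>1 _ {{prime⇒nonTrivial p-prime}}

prime⇒coprime-< : ∀ {q j} → Prime q → 0 ℕ.< j → j ℕ.< q → Coprime q j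
prime⇒coprime-< q-prime 0<j j<q = Coprimality.prime⇒coprime q-prime {{ℕ.>-nonZero 0<j}} j<q

coprime-*-∣ : ∀ {n q m} → Coprime n q → n ∣ m → q ∣ m → n ℕ.* q ∣ m
coprime-*-∣ {n} {q} n⊥q (divides k ≡.refl) q∣kn =
  ≡.subst (_∣ k ℕ.* n) (ℕ.*-comm q n)
    (ℕ.*-monoˡ-∣ n (coprime-divisor (Coprimality.sym n⊥q) (≡.subst (q ∣_) (ℕ.*-comm k n) q∣kn)))

a*pred[q]≤b⇒q*a≤b+a : ∀ q a b .{{_ : NonZero q}} → a ℕ.* ℕ.pred q ℕ.≤ b → q ℕ.* a ℕ.≤ b ℕ.+ a
a*pred[q]≤b⇒q*a≤b+a (suc p) a b a*p≤b = begin
  a ℕ.+ p ℕ.* a  ≡⟨ ≡.cong (a ℕ.+_) (ℕ.*-comm p a) ⟩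
  a ℕ.+ a ℕ.* p  ≤⟨ ℕ.+-monoʳ-≤ a a*p≤b ⟩
  a ℕ.+ b        ≡⟨ ℕ.+-comm a b ⟩
  b ℕ.+ a        ∎
  where open ℕ.≤-Reasoning

b+a≡q*a⇒b≡a*pred[q] : ∀ q a b .{{_ : NonZero q}} → b ℕ.+ a ≡ q ℕ.* a → b ≡ a ℕ.* ℕ.pred q
b+a≡q*a⇒b≡a*pred[q] (suc c) a b eq = ≡.trans
  (ℕ.+-cancelʳ-≡ a b (c ℕ.* a) (≡.trans eq (ℕ.+-comm a (c ℕ.* a)))) (ℕ.*-comm c a)

+m-+n : ∀ {m n} → n ℕ.≤ m → + m ℤ.- + n ≡ + (m ∸ n)
+m-+n {m} {n} n≤m = ≡.trans (ℤ.m-n≡m⊖n m n) (ℤ.⊖-≥ n≤m)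

module _ where

  open ℤSolver.+-*-Solver using (solve; _:=_; _:+_; _:*_; _:-_; :-_)

  i-j-k≡i-k-j : ∀ i j k → i ℤ.- j ℤ.- k ≡ i ℤ.- k ℤ.- j
  i-j-k≡i-k-j = solve 3 (λ i j k → i :- j :- k := i :- k :- j) ≡.refl

  module _ (p q : ℕ) (a b : ℤ) (j : ℕ) (solves : SolvesMod p q a b) where

    ≡⇒∣-residue : b ≡ + j → + p ℤ.∣ (a ℤ.- + q ℤ.* + j)
    ≡⇒∣-residue ≡.refl = Signed.∣⇒∣ᵤ (≡.subst (+ p Signed.∣_)
      (solve 3 (λ q j a → :- (q :* j :- a) := a :- q :* j) ≡.refl (+ q) (+ j) a)
      (Signed.∣m⇒∣-m (Signed.∣ᵤ⇒∣ {+ p} {+ q ℤ.* + j ℤ.- a} (proj₂ (proj₂ solves)))))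

    -- Adding the two divisibilities gives p | q(b - j), hence p | b - j. Both numbers lie in
    -- [0, p - 1], so their difference is zero.
    ∣-residue⇒≡ : Coprime p q → j ℕ.< p → + p ℤ.∣ (a ℤ.- + q ℤ.* + j) → b ≡ + j
    ∣-residue⇒≡ p⊥q j<p p∣a-qj = ℤ.i-j≡0⇒i≡j b (+ j) (ℤ.∣i∣≡0⇒i≡0 (<-∣⇒≡0
      (small b (proj₁ solves) (proj₁ (proj₂ solves)))
      (coprime-divisor p⊥q (≡.subst (p ∣_) (ℤ.abs-* (+ q) (b ℤ.- + j)) (Signed.∣⇒∣ᵤ p∣q[b-j])))))
      where
      p∣q[b-j] : + p Signed.∣ (+ q ℤ.* (b ℤ.- + j))
      p∣q[b-j] = ≡.subst (+ p Signed.∣_)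
        (solve 4 (λ q b j a → (q :* b :- a) :+ (a :- q :* j) := q :* (b :- j)) ≡.refl (+ q) b (+ j) a)
        (Signed.∣m∣n⇒∣m+n (Signed.∣ᵤ⇒∣ {+ p} {+ q ℤ.* b ℤ.- a} (proj₂ (proj₂ solves)))
          (Signed.∣ᵤ⇒∣ {+ p} {a ℤ.- + q ℤ.* + j} p∣a-qj))
      small : ∀ b → 0ℤ ℤ.≤ b → b ℤ.≤ + p ℤ.- 1ℤ → ℤ.∣ b ℤ.- + j ∣ ℕ.< p
      small (+ β) _ β≤p-1 = ℕ.≤-<-trans
        (≡.subst (λ x → ℤ.∣ x ∣ ℕ.≤ β ℕ.⊔ j) (≡.sym (ℤ.m-n≡m⊖n β j)) (ℤ.∣m⊝n∣≤m⊔n β j))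
        (ℕ.⊔-lub (β<p p β≤p-1 j<p) j<p)
        where
        β<p : ∀ p → + β ℤ.≤ + p ℤ.- 1ℤ → j ℕ.< p → β ℕ.< p
        β<p (suc p) β≤p _ = s≤s (ℤ.drop‿+≤+ β≤p)

  𝟏-∈ : ∀ {a b x} → a ℤ.≤ x → x ℤ.≤ b → 𝟏[ a , b ] x ≡ 1ℤ
  𝟏-∈ {a} {b} {x} a≤x x≤b = ≡.cong (if_then 1ℤ else 0ℤ) (dec-true ((a ℤ.≤? x) ×-dec (x ℤ.≤? b)) (a≤x , x≤b))

  𝟏-∉ : ∀ {a b x} → ¬ x ℤ.≤ b → 𝟏[ a , b ] x ≡ 0ℤ
  𝟏-∉ {a} {b} {x} x≰b = ≡.cong (if_then 1ℤ else 0ℤ)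
    (dec-false ((a ℤ.≤? x) ×-dec (x ℤ.≤? b)) (λ (_ , x≤b) → x≰b x≤b))

  𝟏P-< : ∀ {p k} → k ℕ.< p → 𝟏P p (+ k) ≡ 1ℤ
  𝟏P-< {suc p} (s≤s k≤p) = 𝟏-∈ {0ℤ} {+ p} (ℤ.+≤+ z≤n) (ℤ.+≤+ k≤p)

  𝟏P-≥ : ∀ {p k} .{{_ : NonZero p}} → p ℕ.≤ k → 𝟏P p (+ k) ≡ 0ℤ
  𝟏P-≥ {suc p} p<k = 𝟏-∉ {0ℤ} {+ p} (λ k≤p → ℕ.<⇒≱ p<k (ℤ.drop‿+≤+ k≤p))

  m-n≤o⇒ : ∀ {m n o} → + m ℤ.- + n ℤ.≤ + o → m ∸ o ℕ.≤ n
  m-n≤o⇒ {m} {n} {o} h = ℕ.m≤n+o⇒m∸n≤o m o (ℤ.drop‿+≤+ (≡.subst₂ ℤ._≤_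
    (solve 2 (λ m n → (m :- n) :+ n := m) ≡.refl (+ m) (+ n)) ≡.refl (ℤ.+-monoˡ-≤ (+ n) h)))

  m∸o≤n⇒ : ∀ {m n o} → m ∸ o ℕ.≤ n → + m ℤ.- + n ℤ.≤ + o
  m∸o≤n⇒ {m} {n} {o} h = ≡.subst (+ m ℤ.- + n ℤ.≤_)
    (solve 2 (λ o n → (o :+ n) :- n := o) ≡.refl (+ o) (+ n))
    (ℤ.+-monoˡ-≤ (ℤ.- + n) (ℤ.+≤+ (ℕ.≤-trans (ℕ.m≤n+m∸n m o) (ℕ.+-monoʳ-≤ o h))))

  module _ (m y j : ℕ) where

    private
      difference : ∀ d → ℚ.toℚᵘ ((+ m ℚ./ suc d) ℚ.- (+ y ℚ./ suc d)) ℚᵘ.≃ mkℚᵘ (+ m) d ℚᵘ.- mkℚᵘ (+ y) d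
      difference d = ℚᵘ.≃-trans (ℚ.toℚᵘ-homo-+ (+ m ℚ./ suc d) (ℚ.- (+ y ℚ./ suc d)))
        (ℚᵘ.+-cong (ℚ.toℚᵘ-fromℚᵘ (mkℚᵘ (+ m) d))
          (ℚᵘ.≃-trans (ℚ.toℚᵘ-homo‿- (+ y ℚ./ suc d)) (ℚᵘ.-‿cong (ℚ.toℚᵘ-fromℚᵘ (mkℚᵘ (+ y) d)))))

      numerator : ∀ d → (+ m ℤ.* + suc d ℤ.+ (ℤ.- + y) ℤ.* + suc d) ℤ.* 1ℤ ≡ (+ m ℤ.- + y) ℤ.* + suc d
      numerator d = ≡.trans (ℤ.*-identityʳ _)
        (solve 3 (λ m y d → m :* d :+ (:- y) :* d := (m :- y) :* d) ≡.refl (+ m) (+ y) (+ suc d))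

      denominator : ∀ d → + j ℤ.* + (suc d ℕ.* suc d) ≡ + (j ℕ.* suc d) ℤ.* + suc d
      denominator d = ≡.trans (≡.sym (ℤ.pos-* j (suc d ℕ.* suc d)))
        (≡.trans (≡.cong +_ (≡.sym (ℕ.*-assoc j (suc d) (suc d)))) (ℤ.pos-* (j ℕ.* suc d) (suc d)))

    -- This is the membership condition of `I`. The unnormalised difference has denominator n², so
    -- cross-multiplication leaves a surplus factor n to cancel.
    fraction-≤⇒∸-≤ : ∀ n .{{_ : NonZero n}} → (+ m ℚ./ n) ℚ.- (+ y ℚ./ n) ℚ.≤ (+ j ℚ./ 1) → m ∸ j ℕ.* n ℕ.≤ y
    fraction-≤⇒∸-≤ (suc d) h with ℚᵘ.≤-respˡ-≃ (difference d)
      (ℚᵘ.≤-respʳ-≃ (ℚ.toℚᵘ-fromℚᵘ (mkℚᵘ (+ j) 0)) (ℚ.toℚᵘ-mono-≤ h))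
    ... | ℚᵘ.*≤* e = m-n≤o⇒ {m} {y} {j ℕ.* suc d} (ℤ.*-cancelʳ-≤-pos _ _ (+ suc d)
      (≡.subst₂ ℤ._≤_ (numerator d) (denominator d) e))

    ∸-≤⇒fraction-≤ : ∀ n .{{_ : NonZero n}} → m ∸ j ℕ.* n ℕ.≤ y → (+ m ℚ./ n) ℚ.- (+ y ℚ./ n) ℚ.≤ (+ j ℚ./ 1)
    ∸-≤⇒fraction-≤ (suc d) h = ℚ.toℚᵘ-cancel-≤ (ℚᵘ.≤-respˡ-≃ (ℚᵘ.≃-sym (difference d))
      (ℚᵘ.≤-respʳ-≃ (ℚᵘ.≃-sym (ℚ.toℚᵘ-fromℚᵘ (mkℚᵘ (+ j) 0))) (ℚᵘ.*≤*
        (≡.subst₂ ℤ._≤_ (≡.sym (numerator d)) (≡.sym (denominator d))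
          (ℤ.*-monoʳ-≤-nonNeg (+ suc d) (m∸o≤n⇒ {m} {y} {j ℕ.* suc d} h))))))

-- ℂ has no zero divisors

module _ where

  open ℚSolver.+-*-Solver using (solve; _:=_; _:+_; _:*_; _:-_; :-_; con)

  0ᴿ : ℝ
  0ᴿ = fromℚ 0ℚ

  *-pos : ∀ {p q} → 0ℚ ℚ.< p → 0ℚ ℚ.< q → 0ℚ ℚ.< p ℚ.* q
  *-pos {p} {q} p>0 q>0 = ≡.subst (ℚ._< p ℚ.* q) (ℚ.*-zeroʳ p) (ℚ.*-monoʳ-<-pos p {{ℚ.positive p>0}} q>0)

  ½*-pos : ∀ {p} → 0ℚ ℚ.< p → 0ℚ ℚ.< ½ ℚ.* p
  ½*-pos = *-pos (ℚ.positive⁻¹ ½)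

  ½+½ : ∀ p → ½ ℚ.* p ℚ.+ ½ ℚ.* p ≡ p
  ½+½ = solve 1 (λ p → con ½ :* p :+ con ½ :* p := p) ≡.refl

  p≡[p-q]+q : ∀ p q → p ≡ (p ℚ.- q) ℚ.+ q
  p≡[p-q]+q = solve 2 (λ p q → p := (p :- q) :+ q) ≡.refl

  ∣p∣≤∣p-q∣+∣q∣ : ∀ p q → ∣ p ∣ ℚ.≤ ∣ p ℚ.- q ∣ ℚ.+ ∣ q ∣
  ∣p∣≤∣p-q∣+∣q∣ p q = ≡.subst (λ x → ∣ x ∣ ℚ.≤ ∣ p ℚ.- q ∣ ℚ.+ ∣ q ∣) (≡.sym (p≡[p-q]+q p q))
    (ℚ.∣p+q∣≤∣p∣+∣q∣ (p ℚ.- q) q)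

  <⇒≱ : ∀ {p q} → p ℚ.< q → ¬ q ℚ.≤ p
  <⇒≱ p<q q≤p = ℚ.<-irrefl ≡.refl (ℚ.<-≤-trans p<q q≤p)

  VanishesInLimit : ℝ → Set
  VanishesInLimit x = ∀ ε → 0ℚ ℚ.< ε → ∃[ N ] ∀ n → N ℕ.≤ n → ∣ seq x n ∣ ℚ.< ε

  vanishes⇒≈0 : ∀ {x} → VanishesInLimit x → x ≈ᴿ 0ᴿ
  vanishes⇒≈0 {x} h .close ε ε>0 = let N , small = h ε ε>0 in
    N , λ n N≤n → ≡.subst (λ p → ∣ p ∣ ℚ.< ε) (≡.sym (ℚ.+-identityʳ (seq x n))) (small n N≤n)

  ≈0⇒vanishes : ∀ {x} → x ≈ᴿ 0ᴿ → VanishesInLimit x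
  ≈0⇒vanishes {x} x≈0 ε ε>0 = let N , small = close x≈0 ε ε>0 in
    N , λ n N≤n → ≡.subst (λ p → ∣ p ∣ ℚ.< ε) (ℚ.+-identityʳ (seq x n)) (small n N≤n)

  -- Either a late term of y is small, and then so are all later ones, or y is
  -- bounded away from zero, which forces x ≈ᴿ 0.
  ℝ-domain : ∀ x y → x *ᴿ y ≈ᴿ 0ᴿ → ¬ x ≈ᴿ 0ᴿ → y ≈ᴿ 0ᴿ
  ℝ-domain x y xy≈0 x≉0 = vanishes⇒≈0 y-vanishes
    where
    y-vanishes : VanishesInLimit y
    -- The modulus for ε/4 serves both branches. If the term at N is below ε/2, later ones are below
    -- ε/4 + ε/2; otherwise no later term is below ε/4, since that would put the term at N below
    -- ε/2.
    y-vanishes ε ε>0 with cauchy y (½ ℚ.* (½ ℚ.* ε)) (½*-pos (½*-pos ε>0))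
    ... | N , y-cauchy with ∣ seq y N ∣ ℚ.<? ½ ℚ.* ε
    ...   | yes yN<c = N , λ n N≤n → begin-strict
      ∣ seq y n ∣                                ≤⟨ ∣p∣≤∣p-q∣+∣q∣ (seq y n) (seq y N) ⟩
      ∣ seq y n ℚ.- seq y N ∣ ℚ.+ ∣ seq y N ∣    <⟨ ℚ.+-mono-< (y-cauchy n N N≤n ℕ.≤-refl) yN<c ⟩
      d ℚ.+ c                                    <⟨ ℚ.+-monoˡ-< c d<c ⟩
      c ℚ.+ c                                    ≡⟨ ½+½ ε ⟩
      ε                                          ∎
      where
      open ℚ.≤-Reasoning
      c = ½ ℚ.* ε
      d = ½ ℚ.* c
      d<c : d ℚ.< c
      d<c = begin-strict
        d          ≡⟨ ℚ.+-identityʳ d ⟨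
        d ℚ.+ 0ℚ   <⟨ ℚ.+-monoʳ-< d (½*-pos (½*-pos ε>0)) ⟩
        d ℚ.+ d    ≡⟨ ½+½ c ⟩
        c          ∎
    ...   | no yN≮c = contradiction (vanishes⇒≈0 x-vanishes) x≉0
      where
      c = ½ ℚ.* ε
      d = ½ ℚ.* c
      d>0 : 0ℚ ℚ.< d
      d>0 = ½*-pos (½*-pos ε>0)
      instance
        d⁺ : ℚ.Positive d
        d⁺ = ℚ.positive d>0
        d⁰ : ℚ.NonNegative d
        d⁰ = ℚ.pos⇒nonNeg d
      d≤y : ∀ n → N ℕ.≤ n → d ℚ.≤ ∣ seq y n ∣
      d≤y n N≤n = ℚ.≮⇒≥ λ yn<d → yN≮c (begin-strict
        ∣ seq y N ∣                                ≤⟨ ∣p∣≤∣p-q∣+∣q∣ (seq y N) (seq y n) ⟩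
        ∣ seq y N ℚ.- seq y n ∣ ℚ.+ ∣ seq y n ∣    <⟨ ℚ.+-mono-< (y-cauchy N n ℕ.≤-refl N≤n) yn<d ⟩
        d ℚ.+ d                                    ≡⟨ ½+½ c ⟩
        c                                          ∎)
        where open ℚ.≤-Reasoning
      x-vanishes : VanishesInLimit x
      x-vanishes η η>0 with ≈0⇒vanishes xy≈0 (η ℚ.* d) (*-pos η>0 d>0)
      ... | M , xy-small = N ℕ.⊔ M , λ n N⊔M≤n → ℚ.≰⇒> λ η≤x →
        <⇒≱ (xy-small n (ℕ.m⊔n≤o⇒n≤o N M N⊔M≤n)) (begin
          η ℚ.* d                      ≤⟨ ℚ.*-monoʳ-≤-nonNeg d η≤x ⟩
          ∣ seq x n ∣ ℚ.* d            ≤⟨ ℚ.*-monoˡ-≤-nonNeg ∣ seq x n ∣ (d≤y n (ℕ.m⊔n≤o⇒m≤o N M N⊔M≤n)) ⟩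
          ∣ seq x n ∣ ℚ.* ∣ seq y n ∣  ≡⟨ ℚ.∣p*q∣≡∣p∣*∣q∣ (seq x n) (seq y n) ⟨
          ∣ seq x n ℚ.* seq y n ∣      ∎)
        where
        open ℚ.≤-Reasoning
        instance
          ∣x∣⁰ : ∀ {n} → ℚ.NonNegative ∣ seq x n ∣
          ∣x∣⁰ {n} = ℚ.nonNegative (ℚ.0≤∣p∣ (seq x n))

  -- The sum of squares is tested against ε²: a term of x of size at least ε would make it at least
  -- ε², as y² is nonnegative.
  x²+y²≈0⇒x≈0 : ∀ x y → x *ᴿ x +ᴿ y *ᴿ y ≈ᴿ 0ᴿ → x ≈ᴿ 0ᴿ
  x²+y²≈0⇒x≈0 x y h = vanishes⇒≈0 λ ε ε>0 →
    let N , small = ≈0⇒vanishes h (ε ℚ.* ε) (*-pos ε>0 ε>0) in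
    N , λ n N≤n → ℚ.≰⇒> λ ε≤x → <⇒≱ (small n N≤n) (bound ε ε>0 (seq x n) (seq y n) ε≤x)
    where
    open ℚ.≤-Reasoning
    square : ∀ p → ∣ p ∣ ℚ.* ∣ p ∣ ≡ p ℚ.* p
    square p = ≡.trans (≡.sym (ℚ.∣p*q∣≡∣p∣*∣q∣ p p)) (ℚ.0≤p⇒∣p∣≡p (0≤p*p p))
      where
      0≤p*p : ∀ p → 0ℚ ℚ.≤ p ℚ.* p
      0≤p*p p with ℚ.≤-total 0ℚ p
      ... | inj₁ 0≤p = ≡.subst (ℚ._≤ p ℚ.* p) (ℚ.*-zeroˡ p) (ℚ.*-monoʳ-≤-nonNeg p {{ℚ.nonNegative 0≤p}} 0≤p)
      ... | inj₂ p≤0 = ≡.subst (ℚ._≤ p ℚ.* p) (ℚ.*-zeroˡ p) (ℚ.*-monoʳ-≤-nonPos p {{ℚ.nonPositive p≤0}} p≤0)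
    bound : ∀ ε → 0ℚ ℚ.< ε → ∀ p q → ε ℚ.≤ ∣ p ∣ → ε ℚ.* ε ℚ.≤ ∣ p ℚ.* p ℚ.+ q ℚ.* q ∣
    bound ε ε>0 p q ε≤p = begin
      ε ℚ.* ε                      ≤⟨ ℚ.*-monoʳ-≤-nonNeg ε {{ℚ.nonNegative (ℚ.<⇒≤ ε>0)}} ε≤p ⟩
      ∣ p ∣ ℚ.* ε                  ≤⟨ ℚ.*-monoˡ-≤-nonNeg ∣ p ∣ {{ℚ.nonNegative (ℚ.0≤∣p∣ p)}} ε≤p ⟩
      ∣ p ∣ ℚ.* ∣ p ∣              ≡⟨ square p ⟩
      p ℚ.* p                      ≡⟨ ℚ.+-identityʳ (p ℚ.* p) ⟨
      p ℚ.* p ℚ.+ 0ℚ               ≤⟨ ℚ.+-monoʳ-≤ (p ℚ.* p) 0≤q² ⟩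
      p ℚ.* p ℚ.+ q ℚ.* q          ≡⟨ ℚ.0≤p⇒∣p∣≡p (ℚ.≤-trans (ℚ.≤-reflexive (≡.sym (ℚ.+-identityʳ 0ℚ))) (ℚ.+-mono-≤ 0≤p² 0≤q²)) ⟨
      ∣ p ℚ.* p ℚ.+ q ℚ.* q ∣      ∎
      where
      0≤p² : 0ℚ ℚ.≤ p ℚ.* p
      0≤p² = ≡.subst (0ℚ ℚ.≤_) (≡.trans (ℚ.∣p*q∣≡∣p∣*∣q∣ p p) (square p)) (ℚ.0≤∣p∣ (p ℚ.* p))
      0≤q² : 0ℚ ℚ.≤ q ℚ.* q
      0≤q² = ≡.subst (0ℚ ℚ.≤_) (≡.trans (ℚ.∣p*q∣≡∣p∣*∣q∣ q q) (square q)) (ℚ.0≤∣p∣ (q ℚ.* q))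

  -- Multiplying by the conjugate of z reduces the claim to the norm of z, a real number.
  ℂ-domain : ∀ {z w} → z * w ≈ 0# → ¬ z ≈ 0# → w ≈ 0#
  ℂ-domain {z} {w} (re≈ , im≈) z≉0 = ℝ-domain N c Nc≈0 N≉0 , ℝ-domain N d Nd≈0 N≉0
    where
    a = re z
    b = im z
    c = re w
    d = im w
    N = a *ᴿ a +ᴿ b *ᴿ b
    x0+y0≈0 : ∀ x y → x *ᴿ 0ᴿ +ᴿ y *ᴿ 0ᴿ ≈ᴿ 0ᴿ
    x0+y0≈0 x y = ≈ᴿ-pointwise λ n →
      solve 2 (λ x y → x :* con 0ℚ :+ y :* con 0ℚ := con 0ℚ) ≡.refl (seq x n) (seq y n)
    Nc≈0 : N *ᴿ c ≈ᴿ 0ᴿ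
    Nc≈0 = ≈ᴿ-trans {y = a *ᴿ re (z * w) +ᴿ b *ᴿ im (z * w)}
      (≈ᴿ-pointwise λ n → solve 4 (λ a b c d →
          (a :* a :+ b :* b) :* c := a :* (a :* c :+ :- (b :* d)) :+ b :* (a :* d :+ b :* c)) ≡.refl
        (seq a n) (seq b n) (seq c n) (seq d n))
      (≈ᴿ-trans (+ᴿ-cong (*ᴿ-cong ≈ᴿ-refl re≈) (*ᴿ-cong ≈ᴿ-refl im≈)) (x0+y0≈0 a b))
    Nd≈0 : N *ᴿ d ≈ᴿ 0ᴿ
    Nd≈0 = ≈ᴿ-trans {y = a *ᴿ im (z * w) +ᴿ (-ᴿ b) *ᴿ re (z * w)}
      (≈ᴿ-pointwise λ n → solve 4 (λ a b c d →
          (a :* a :+ b :* b) :* d := a :* (a :* d :+ b :* c) :+ :- b :* (a :* c :+ :- (b :* d))) ≡.refl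
        (seq a n) (seq b n) (seq c n) (seq d n))
      (≈ᴿ-trans (+ᴿ-cong (*ᴿ-cong ≈ᴿ-refl im≈) (*ᴿ-cong ≈ᴿ-refl re≈)) (x0+y0≈0 a (-ᴿ b)))
    N≉0 : ¬ N ≈ᴿ 0ᴿ
    N≉0 N≈0 = z≉0 (x²+y²≈0⇒x≈0 a b N≈0 , x²+y²≈0⇒x≈0 b a (≈ᴿ-trans
      (≈ᴿ-pointwise λ n → ℚ.+-comm (seq b n ℚ.* seq b n) (seq a n ℚ.* seq a n)) N≈0))

  1≉0 : ¬ 1# ≈ 0#
  1≉0 (re≈ , _) = let N , 1<1 = close re≈ 1ℚ (ℚ.positive⁻¹ 1ℚ) in ℚ.<-irrefl ≡.refl (1<1 N ℕ.≤-refl)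

open CommutativeRing ℂ-commutativeRing
  using ( ring; commutativeSemiring; setoid; trans; sym; reflexive; _-_; -‿cong
        ; +-cong; +-congˡ; +-assoc; +-comm; +-identityˡ; +-identityʳ; *-cong; *-congˡ; *-congʳ
        ; *-assoc; *-comm; *-identityˡ; *-identityʳ; zeroʳ; distribˡ)
  renaming (refl to ≈-refl)
open RingProperties ring using (-1*x≈-x; -0#≈0#)
open Exp ℂ-semiring using (^-congˡ; ^-congʳ; ^-homo-*; ^-assocʳ)
open CommutativeExp commutativeSemiring using (^-distrib-*)
open PowerSeries ℂ-commutativeRing
open SetoidMembership ℂ-setoid using (_∈_)
open SetoidUnique ℂ-setoid using (Unique)
open Lists𝓩*
open SetoidReasoning setoid

-- The generating functions of the symmetric polynomials

∑Fin : ∀ {r} → (Fin r → ℂ) → ℂ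
∑Fin F = foldr _+_ 0# (tabulate F)

∑Fin-cong : ∀ {r} {F G : Fin r → ℂ} → (∀ i → F i ≈ G i) → ∑Fin F ≈ ∑Fin G
∑Fin-cong {zero}  p = ≈-refl
∑Fin-cong {suc r} p = +-cong (p zero) (∑Fin-cong (p ∘ suc))

∑Fin-*ˡ : ∀ {r} a (F : Fin r → ℂ) → ∑Fin (λ i → a * F i) ≈ a * ∑Fin F
∑Fin-*ˡ {zero}  a F = sym (zeroʳ a)
∑Fin-*ˡ {suc r} a F = trans (+-congˡ (∑Fin-*ˡ a (F ∘ suc))) (sym (distribˡ _ _ _))

-- The sum over the tuples i ∷ js linked by ρ, with js of length m.
chainsFrom : ∀ {r} → (Fin r → Fin r → Bool) → (Fin r → ℂ) → Fin r → ℕ → ℂ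
chainsFrom ρ v i zero    = v i
chainsFrom ρ v i (suc m) = ∑Fin (λ k → if ρ i k then v i * chainsFrom ρ v k m else 0#)

module _ {r} {R : Rel (Fin r) 0ℓ} (R? : Binary.Decidable R) (v : Fin r → ℂ) where

  linkedSum : List (List (Fin r)) → ℂ
  linkedSum L = ∑[ js ∈ filter (linked? R?) L ] ∏ (map v js)

  private
    chains : Fin r → ℕ → ℂ
    chains = chainsFrom (λ i k → does (R? i k)) v

  linkedSum-++ : ∀ L L′ → linkedSum (L ++ L′) ≈ linkedSum L + linkedSum L′
  linkedSum-++ []       L′ = sym (+-identityˡ _)
  linkedSum-++ (js ∷ L) L′ with does (linked? R? js)
  ... | true  = trans (+-congˡ (linkedSum-++ L L′)) (sym (+-assoc _ _ _))
  ... | false = linkedSum-++ L L′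

  -- `g` lets the induction run along `tabulate`; `f` is the identity for whole tuples and `i ∷_`
  -- once a head is fixed.
  linkedSum-product : ∀ {s} (g : Fin s → Fin r) T {f : List (Fin r) → List (Fin r)} →
    linkedSum (map f (cartesianProductWith _∷_ (tabulate g) T)) ≈ ∑Fin (λ k → linkedSum (map f (map (g k ∷_) T)))
  linkedSum-product {zero}  g T = ≈-refl
  linkedSum-product {suc s} g T {f} = begin
    linkedSum (map f (map (g zero ∷_) T ++ cartesianProductWith _∷_ (tabulate (g ∘ suc)) T))
      ≡⟨ ≡.cong linkedSum (List.map-++ f (map (g zero ∷_) T) _) ⟩
    linkedSum (map f (map (g zero ∷_) T) ++ map f (cartesianProductWith _∷_ (tabulate (g ∘ suc)) T))
      ≈⟨ linkedSum-++ (map f (map (g zero ∷_) T)) _ ⟩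
    _ ≈⟨ +-congˡ (linkedSum-product (g ∘ suc) T) ⟩
    _ ∎

  -- Being linked splits into a test on the first two entries, the same for all of `T`, and being
  -- linked from the second entry on.
  linkedSum-∷∷ : ∀ i k T → linkedSum (map (i ∷_) (map (k ∷_) T)) ≈
    (if does (R? i k) then v i * linkedSum (map (k ∷_) T) else 0#)
  linkedSum-∷∷ i k [] with does (R? i k)
  ... | true  = sym (zeroʳ _)
  ... | false = ≈-refl
  linkedSum-∷∷ i k (js ∷ T) with does (R? i k) | linkedSum-∷∷ i k T
  ... | false | rec = rec
  ... | true  | rec with does (linked? R? (k ∷ js))
  ...   | true  = trans (+-congˡ rec) (sym (distribˡ _ _ _))
  ...   | false = rec

  linkedSum-∷ : ∀ i m → linkedSum (map (i ∷_) (tuples r m)) ≈ chains i m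
  linkedSum-∷ i zero    = trans (+-identityʳ _) (*-identityʳ _)
  linkedSum-∷ i (suc m) = trans (linkedSum-product id (tuples r m)) (∑Fin-cong λ k →
    trans (linkedSum-∷∷ i k (tuples r m)) (lemma k))
    where
    lemma : ∀ k → (if does (R? i k) then v i * linkedSum (map (k ∷_) (tuples r m)) else 0#) ≈
                  (if does (R? i k) then v i * chains k m else 0#)
    lemma k with does (R? i k)
    ... | true  = *-congˡ (linkedSum-∷ k m)
    ... | false = ≈-refl

  linkedSum-tuples-zero : linkedSum (tuples r zero) ≈ 1#
  linkedSum-tuples-zero = +-identityʳ 1#

  linkedSum-tuples-suc : ∀ m → linkedSum (tuples r (suc m)) ≈ ∑Fin (λ k → chains k m)
  linkedSum-tuples-suc m = begin
    linkedSum (tuples r (suc m))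
      ≡⟨ ≡.cong linkedSum (List.map-id (tuples r (suc m))) ⟨
    linkedSum (map id (tuples r (suc m)))
      ≈⟨ linkedSum-product id (tuples r m) ⟩
    ∑Fin (λ k → linkedSum (map id (map (k ∷_) (tuples r m))))
      ≈⟨ ∑Fin-cong (λ k → trans
           (reflexive (≡.cong linkedSum (List.map-id (map (k ∷_) (tuples r m))))) (linkedSum-∷ k m)) ⟩
    ∑Fin (λ k → chains k m) ∎

_≤ᵇ_ _<ᵇ_ : ∀ {r} → Fin r → Fin r → Bool
i ≤ᵇ k = does (i Fin.≤? k)
i <ᵇ k = does (i Fin.<? k)

-- A chain that starts past position zero never returns to it, so it is a chain over the remaining
-- list.
chainsFrom-suc : ∀ {r} (ρ : Fin (suc r) → Fin (suc r) → Bool) (σ : Fin r → Fin r → Bool) v →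
  (∀ i → ρ (suc i) zero ≡ false) → (∀ i k → ρ (suc i) (suc k) ≡ σ i k) →
  ∀ i m → chainsFrom ρ v (suc i) m ≈ chainsFrom σ (v ∘ suc) i m
chainsFrom-suc ρ σ v ρ₀ ρ₊ i zero    = ≈-refl
chainsFrom-suc ρ σ v ρ₀ ρ₊ i (suc m) rewrite ρ₀ i =
  trans (+-identityˡ _) (∑Fin-cong λ k → step k)
  where
  step : ∀ k → (if ρ (suc i) (suc k) then v (suc i) * chainsFrom ρ v (suc k) m else 0#) ≈
               (if σ i k then v (suc i) * chainsFrom σ (v ∘ suc) k m else 0#)
  step k rewrite ρ₊ i k with σ i k
  ... | true  = *-congˡ (chainsFrom-suc ρ σ v ρ₀ ρ₊ k m)
  ... | false = ≈-refl

≤ᵇ-suc : ∀ {r} (i k : Fin r) → suc i ≤ᵇ suc k ≡ i ≤ᵇ k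
≤ᵇ-suc zero    k = ≡.refl
≤ᵇ-suc (suc i) k = ≡.refl

𝓗-zero : ∀ A → 𝓗 0 A ≈ 1#
𝓗-zero A = linkedSum-tuples-zero Fin._≤?_ (lookup A)

-- A weakly increasing sequence either avoids position zero or starts there. In the second case the
-- rest may use zero again, hence `z ∷ A` in the last factor.
𝓗-∷ : ∀ m z A → 𝓗 (suc m) (z ∷ A) ≈ 𝓗 (suc m) A + z * 𝓗 m (z ∷ A)
𝓗-∷ m z A = begin
  𝓗 (suc m) (z ∷ A)
    ≈⟨ linkedSum-tuples-suc Fin._≤?_ (lookup (z ∷ A)) m ⟩
  chainsFrom _≤ᵇ_ (lookup (z ∷ A)) zero m + ∑Fin (λ k → chainsFrom _≤ᵇ_ (lookup (z ∷ A)) (suc k) m)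
    ≈⟨ +-cong (from-zero m) (∑Fin-cong λ k →
         chainsFrom-suc _≤ᵇ_ _≤ᵇ_ (lookup (z ∷ A)) (λ _ → ≡.refl) ≤ᵇ-suc k m) ⟩
  z * 𝓗 m (z ∷ A) + ∑Fin (λ k → chainsFrom _≤ᵇ_ (lookup A) k m)
    ≈⟨ +-congˡ (linkedSum-tuples-suc Fin._≤?_ (lookup A) m) ⟨
  z * 𝓗 m (z ∷ A) + 𝓗 (suc m) A
    ≈⟨ +-comm _ _ ⟩
  𝓗 (suc m) A + z * 𝓗 m (z ∷ A) ∎
  where
  from-zero : ∀ m → chainsFrom _≤ᵇ_ (lookup (z ∷ A)) zero m ≈ z * 𝓗 m (z ∷ A)
  from-zero zero    = trans (sym (*-identityʳ z)) (*-congˡ (sym (𝓗-zero (z ∷ A))))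
  -- `zero ≤ᵇ k` reduces to true for every `k`, so no condition is left in the sum.
  from-zero (suc m) = trans (∑Fin-*ˡ z (λ k → chainsFrom _≤ᵇ_ (lookup (z ∷ A)) k m))
    (*-congˡ (sym (linkedSum-tuples-suc Fin._≤?_ (lookup (z ∷ A)) m)))

𝓔-zero : ∀ A → 𝓔 0 A ≈ 1#
𝓔-zero A = linkedSum-tuples-zero Fin._<?_ (lookup A)

-- The same split for strictly increasing sequences; after position zero the rest lies in `A`.
𝓔-∷ : ∀ m z A → 𝓔 (suc m) (z ∷ A) ≈ 𝓔 (suc m) A + z * 𝓔 m A
𝓔-∷ m z A = begin
  𝓔 (suc m) (z ∷ A)
    ≈⟨ linkedSum-tuples-suc Fin._<?_ (lookup (z ∷ A)) m ⟩
  chainsFrom _<ᵇ_ (lookup (z ∷ A)) zero m + ∑Fin (λ k → chainsFrom _<ᵇ_ (lookup (z ∷ A)) (suc k) m)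
    ≈⟨ +-cong (from-zero m) (∑Fin-cong λ k → from-suc k m) ⟩
  z * 𝓔 m A + ∑Fin (λ k → chainsFrom _<ᵇ_ (lookup A) k m)
    ≈⟨ +-congˡ (linkedSum-tuples-suc Fin._<?_ (lookup A) m) ⟨
  z * 𝓔 m A + 𝓔 (suc m) A
    ≈⟨ +-comm _ _ ⟩
  𝓔 (suc m) A + z * 𝓔 m A ∎
  where
  from-suc : ∀ i m → chainsFrom _<ᵇ_ (lookup (z ∷ A)) (suc i) m ≈ chainsFrom _<ᵇ_ (lookup A) i m
  from-suc = chainsFrom-suc _<ᵇ_ _<ᵇ_ (lookup (z ∷ A)) (λ _ → ≡.refl) (λ _ _ → ≡.refl)
  from-zero : ∀ m → chainsFrom _<ᵇ_ (lookup (z ∷ A)) zero m ≈ z * 𝓔 m A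
  from-zero zero    = trans (sym (*-identityʳ z)) (*-congˡ (sym (𝓔-zero A)))
  -- `zero <ᵇ zero` is false, which makes the first summand 0; all later tests succeed.
  from-zero (suc m) = trans (+-identityˡ _) (trans (∑Fin-*ˡ z (λ k → chainsFrom _<ᵇ_ (lookup (z ∷ A)) (suc k) m))
    (*-congˡ (trans (∑Fin-cong λ k → from-suc k m) (sym (linkedSum-tuples-suc Fin._<?_ (lookup A) m)))))

𝓗≈hSeries : ∀ m A → 𝓗 m A ≈ hSeries A m
𝓗≈hSeries zero    []      = +-identityʳ 1#
𝓗≈hSeries (suc m) []      = ≈-refl
𝓗≈hSeries zero    (z ∷ A) = trans (trans (𝓗-zero (z ∷ A)) (sym (𝓗-zero A))) (𝓗≈hSeries zero A)
𝓗≈hSeries (suc m) (z ∷ A) = trans (𝓗-∷ m z A) (+-cong (𝓗≈hSeries (suc m) A) (*-congˡ (𝓗≈hSeries m (z ∷ A))))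

𝓔≈eSeries : ∀ m A → (- 1#) ^ m * 𝓔 m A ≈ eSeries A m
𝓔≈eSeries zero    []      = trans (*-identityˡ _) (+-identityʳ 1#)
𝓔≈eSeries (suc m) []      = zeroʳ _
𝓔≈eSeries zero    (z ∷ A) = trans (*-congˡ (trans (𝓔-zero (z ∷ A)) (sym (𝓔-zero A)))) (𝓔≈eSeries zero A)
𝓔≈eSeries (suc m) (z ∷ A) = begin
  (- 1#) ^ suc m * 𝓔 (suc m) (z ∷ A)
    ≈⟨ *-congˡ (𝓔-∷ m z A) ⟩
  (- 1#) ^ suc m * (𝓔 (suc m) A + z * 𝓔 m A)
    ≈⟨ distribˡ _ _ _ ⟩
  (- 1#) ^ suc m * 𝓔 (suc m) A + (- 1#) ^ suc m * (z * 𝓔 m A)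
    ≈⟨ +-cong (𝓔≈eSeries (suc m) A) (sign ((- 1#) ^ m) (𝓔 m A)) ⟩
  eSeries A (suc m) + - z * ((- 1#) ^ m * 𝓔 m A)
    ≈⟨ +-congˡ (*-congˡ (𝓔≈eSeries m A)) ⟩
  eSeries A (suc m) + - z * eSeries A m ∎
  where
  sign : ∀ s x → - 1# * s * (z * x) ≈ - z * (s * x)
  sign s x = begin
    - 1# * s * (z * x)    ≈⟨ *-assoc _ _ _ ⟩
    - 1# * (s * (z * x))  ≈⟨ *-congˡ (trans (sym (*-assoc _ _ _)) (trans (*-congʳ (*-comm s z)) (*-assoc _ _ _))) ⟩
    - 1# * (z * (s * x))  ≈⟨ *-assoc _ _ _ ⟨
    - 1# * z * (s * x)    ≈⟨ *-congʳ (-1*x≈-x z) ⟩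
    - z * (s * x)         ∎

-- Primitive roots of unity

1^n≈1 : ∀ n → 1# ^ n ≈ 1#
1^n≈1 zero    = ≈-refl
1^n≈1 (suc n) = trans (*-identityˡ _) (1^n≈1 n)

z^n≈1⇒z^[n*k]≈1 : ∀ {z} n k → z ^ n ≈ 1# → z ^ (n ℕ.* k) ≈ 1#
z^n≈1⇒z^[n*k]≈1 {z} n k zⁿ≈1 = begin
  z ^ (n ℕ.* k)  ≈⟨ ^-assocʳ z n k ⟨
  (z ^ n) ^ k    ≈⟨ ^-congˡ k zⁿ≈1 ⟩
  1# ^ k         ≈⟨ 1^n≈1 k ⟩
  1#             ∎

∣⇒z^m≈1 : ∀ z n {m} → z ^ n ≈ 1# → n ∣ m → z ^ m ≈ 1#
∣⇒z^m≈1 z n zⁿ≈1 (divides k ≡.refl) = trans (^-congʳ z (ℕ.*-comm k n)) (z^n≈1⇒z^[n*k]≈1 n k zⁿ≈1)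

-- Division with remainder: z to the power m % n is also 1, so minimality forces the remainder to be
-- zero.
order-∣ : ∀ {n z m} .{{_ : NonZero n}} → IsPrimitiveRoot n z → z ^ m ≈ 1# → n ∣ m
order-∣ {n} {z} {m} (zⁿ≈1 , minimal) zᵐ≈1 with m ℕ.% n in eq
... | zero  = ℕ.m%n≡0⇒n∣m m n eq
... | suc r = contradiction (begin
  z ^ suc r                                 ≡⟨ ≡.cong (z ^_) eq ⟨
  z ^ (m ℕ.% n)                             ≈⟨ *-identityʳ _ ⟨
  z ^ (m ℕ.% n) * 1#                        ≈⟨ *-congˡ (∣⇒z^m≈1 z n zⁿ≈1 (ℕ.n∣m*n (m ℕ./ n))) ⟨
  z ^ (m ℕ.% n) * z ^ (m ℕ./ n ℕ.* n)       ≈⟨ ^-homo-* z (m ℕ.% n) (m ℕ./ n ℕ.* n) ⟨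
  z ^ (m ℕ.% n ℕ.+ m ℕ./ n ℕ.* n)           ≡⟨ ≡.cong (z ^_) (ℕ.m≡m%n+[m/n]*n m n) ⟨
  z ^ m                                     ≈⟨ zᵐ≈1 ⟩
  1#                                        ∎)
  (minimal (suc r) (s≤s z≤n) (≡.subst (ℕ._< n) eq (ℕ.m%n<n m n)))

-- Divisibility is the convenient form of the order: it passes through powers by cancelling coprime
-- or common factors.
isPrimitiveRoot : ∀ {n z} → z ^ n ≈ 1# → (∀ {m} → z ^ m ≈ 1# → n ∣ m) → IsPrimitiveRoot n z
isPrimitiveRoot zⁿ≈1 order = zⁿ≈1 , λ k 0<k k<n zᵏ≈1 → ℕ.<⇒≱ k<n (ℕ.∣⇒≤ {{ℕ.>-nonZero 0<k}} (order zᵏ≈1))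

^-primitive-coprime : ∀ {n q z} .{{_ : NonZero n}} → Coprime n q → IsPrimitiveRoot n z → IsPrimitiveRoot n (z ^ q)
^-primitive-coprime {n} {q} {z} n⊥q prim = isPrimitiveRoot
  (trans (^-assocʳ z q n) (∣⇒z^m≈1 z n (proj₁ prim) (ℕ.n∣m*n q)))
  (λ {m} h → coprime-divisor n⊥q (order-∣ prim (trans (sym (^-assocʳ z q m)) h)))

^-primitive-* : ∀ {n q z} .{{_ : NonZero n}} .{{_ : NonZero q}} →
  IsPrimitiveRoot (n ℕ.* q) z → IsPrimitiveRoot n (z ^ q)
^-primitive-* {n} {q} {z} prim = isPrimitiveRoot
  (trans (^-assocʳ z q n) (trans (^-congʳ z (ℕ.*-comm q n)) (proj₁ prim)))
  (λ {m} h → ℕ.*-cancelˡ-∣ q (≡.subst (_∣ q ℕ.* m) (ℕ.*-comm n q)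
    (order-∣ {{ℕ.m*n≢0 n q}} prim (trans (sym (^-assocʳ z q m)) h))))

-- Raising (w η)ᵐ = 1 to the powers n and q separates the two factors.
*-primitive : ∀ {n q w η} .{{_ : NonZero n}} .{{_ : NonZero q}} → Coprime n q →
  IsPrimitiveRoot n w → IsPrimitiveRoot q η → IsPrimitiveRoot (n ℕ.* q) (w * η)
*-primitive {n} {q} {w} {η} n⊥q w-prim η-prim = isPrimitiveRoot
  (begin
    (w * η) ^ (n ℕ.* q)          ≈⟨ ^-distrib-* w η (n ℕ.* q) ⟩
    w ^ (n ℕ.* q) * η ^ (n ℕ.* q)
      ≈⟨ *-cong (∣⇒z^m≈1 w n (proj₁ w-prim) (ℕ.m∣m*n q)) (∣⇒z^m≈1 η q (proj₁ η-prim) (ℕ.n∣m*n n)) ⟩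
    1# * 1#                      ≈⟨ *-identityˡ 1# ⟩
    1#                           ∎)
  λ {m} h → coprime-*-∣ n⊥q
    (coprime-divisor n⊥q (order-∣ w-prim (begin
      w ^ (q ℕ.* m)                ≈⟨ *-identityʳ _ ⟨
      w ^ (q ℕ.* m) * 1#           ≈⟨ *-congˡ (∣⇒z^m≈1 η q (proj₁ η-prim) (ℕ.m∣m*n m)) ⟨
      w ^ (q ℕ.* m) * η ^ (q ℕ.* m) ≈⟨ power-one q m h ⟩
      1#                           ∎)))
    (coprime-divisor (Coprimality.sym n⊥q) (order-∣ η-prim (begin
      η ^ (n ℕ.* m)                ≈⟨ *-identityˡ _ ⟨
      1# * η ^ (n ℕ.* m)           ≈⟨ *-congʳ (∣⇒z^m≈1 w n (proj₁ w-prim) (ℕ.m∣m*n m)) ⟨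
      w ^ (n ℕ.* m) * η ^ (n ℕ.* m) ≈⟨ power-one n m h ⟩
      1#                           ∎)))
  where
  power-one : ∀ k m → (w * η) ^ m ≈ 1# → w ^ (k ℕ.* m) * η ^ (k ℕ.* m) ≈ 1#
  power-one k m h = trans (sym (^-distrib-* w η (k ℕ.* m))) (∣⇒z^m≈1 (w * η) m h (ℕ.n∣m*n k))

-- The inverse of a root of unity is one of its powers, the one with exponent n - 1.
root-cancelˡ : ∀ {n z x y} .{{_ : NonZero n}} → z ^ n ≈ 1# → z * x ≈ z * y → x ≈ y
root-cancelˡ {suc n} {z} {x} {y} zⁿ⁺¹≈1 zx≈zy = trans (sym (undo x)) (trans (*-congˡ zx≈zy) (undo y))
  where
  undo : ∀ x → z ^ n * (z * x) ≈ x
  undo x = begin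
    z ^ n * (z * x)  ≈⟨ *-assoc _ _ _ ⟨
    z ^ n * z * x    ≈⟨ *-congʳ (*-comm _ _) ⟩
    z ^ suc n * x    ≈⟨ *-congʳ zⁿ⁺¹≈1 ⟩
    1# * x           ≈⟨ *-identityˡ x ⟩
    x                ∎

root-^-≉ : ∀ {n z i j} .{{_ : NonZero n}} → IsPrimitiveRoot n z → i ℕ.< j → j ℕ.< n → ¬ z ^ i ≈ z ^ j
root-^-≉ {n} {z} {i} {j} prim i<j j<n eq =
  proj₂ prim (j ℕ.∸ i) (ℕ.m<n⇒0<n∸m i<j) (ℕ.≤-<-trans (ℕ.m∸n≤m j i) j<n)
    (sym (root-cancelˡ {n} {z ^ i} (trans (^-assocʳ z i n) (∣⇒z^m≈1 z n (proj₁ prim) (ℕ.n∣m*n i))) (begin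
      z ^ i * 1#             ≈⟨ *-identityʳ _ ⟩
      z ^ i                  ≈⟨ eq ⟩
      z ^ j                  ≡⟨ ≡.cong (z ^_) (ℕ.m+[n∸m]≡n (ℕ.<⇒≤ i<j)) ⟨
      z ^ (i ℕ.+ (j ℕ.∸ i))  ≈⟨ ^-homo-* z i (j ℕ.∸ i) ⟩
      z ^ i * z ^ (j ℕ.∸ i)  ∎)))

root-^-injective : ∀ {n z i j} .{{_ : NonZero n}} →
  IsPrimitiveRoot n z → i ℕ.< n → j ℕ.< n → z ^ i ≈ z ^ j → i ≡ j
root-^-injective {i = i} {j} prim i<n j<n eq with ℕ.<-cmp i j
... | tri< i<j _ _ = contradiction eq (root-^-≉ prim i<j j<n)
... | tri≈ _ i≡j _ = i≡j
... | tri> _ _ j<i = contradiction (sym eq) (root-^-≉ prim j<i i<n)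

lookup-injective : ∀ {A} → Unique A → ∀ {i j} → lookup A i ≈ lookup A j → i ≡ j
lookup-injective (x∉A ∷ uniq) {zero}  {zero}  eq = ≡.refl
lookup-injective {x ∷ A} (x∉A ∷ uniq) {zero}  {suc j} eq =
  contradiction (Membership.∈-resp-≈ ℂ-setoid (sym eq) (Membership.∈-lookup ℂ-setoid A j)) (All.All¬⇒¬Any x∉A)
lookup-injective {x ∷ A} (x∉A ∷ uniq) {suc i} {zero}  eq =
  contradiction (Membership.∈-resp-≈ ℂ-setoid eq (Membership.∈-lookup ℂ-setoid A i)) (All.All¬⇒¬Any x∉A)
lookup-injective (x∉A ∷ uniq) {suc i} {suc j} eq = ≡.cong suc (lookup-injective uniq eq)

-- Comparing the roots of orders n and nq

module _ {n q : ℕ} .{{_ : NonZero n}} (q-prime : Prime q) (n⊥q : Coprime n q)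
         {A B : List ℂ} (listsA : Lists𝓩* n A) (listsB : Lists𝓩* (n ℕ.* q) B) where

  private
    instance
      q≢0 : NonZero q
      q≢0 = prime⇒nonZero q-prime

    -- Since `B` is nonempty it has a member of order nq, and the n-th power of that member has
    -- order q.
    ζ : ℂ
    ζ = lookup B (Fin.fromℕ< (nonempty listsB))

    η : ℂ
    η = ζ ^ n

    η-primitive : IsPrimitiveRoot q η
    η-primitive = ^-primitive-* {q} {n} {ζ} (≡.subst (λ k → IsPrimitiveRoot k ζ) (ℕ.*-comm n q)
      (sound listsB ζ (Membership.∈-lookup ℂ-setoid B _)))

    -- Counting these elements of B bounds length B from below.
    product : Fin (length A) → Fin (ℕ.pred q) → ℂ
    product i k = lookup A i * η ^ suc (toℕ k)

    1+k<q : (k : Fin (ℕ.pred q)) → suc (toℕ k) ℕ.< q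
    1+k<q k = ℕ.<-≤-trans (s≤s (Fin.toℕ<n k)) (ℕ.≤-reflexive (ℕ.suc-pred q))

    A-primitive : ∀ i → IsPrimitiveRoot n (lookup A i)
    A-primitive i = sound listsA _ (Membership.∈-lookup ℂ-setoid A i)

    product∈B : ∀ i k → product i k ∈ B
    product∈B i k = complete listsB _ (*-primitive {n} {q} {lookup A i} n⊥q (A-primitive i)
      -- The exponents run from 1 to q - 1, hence are coprime to q and keep the order of `η`.
      (^-primitive-coprime {q} {suc (toℕ k)} {η} (prime⇒coprime-< q-prime (s≤s z≤n) (1+k<q k)) η-primitive))

    product-^n : ∀ i k → product i k ^ n ≈ (η ^ n) ^ suc (toℕ k)
    product-^n i k = begin
      product i k ^ n                               ≈⟨ ^-distrib-* (lookup A i) (η ^ suc (toℕ k)) n ⟩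
      lookup A i ^ n * (η ^ suc (toℕ k)) ^ n        ≈⟨ *-cong (proj₁ (A-primitive i)) (^-assocʳ η (suc (toℕ k)) n) ⟩
      1# * η ^ (suc (toℕ k) ℕ.* n)                  ≈⟨ *-identityˡ _ ⟩
      η ^ (suc (toℕ k) ℕ.* n)                       ≈⟨ ^-congʳ η (ℕ.*-comm (suc (toℕ k)) n) ⟩
      η ^ (n ℕ.* suc (toℕ k))                       ≈⟨ ^-assocʳ η n (suc (toℕ k)) ⟨
      (η ^ n) ^ suc (toℕ k)                         ∎

    -- The n-th power kills the factor from `A` and leaves a power of `η ^ n`. As n is coprime to q,
    -- this still has order q, so an exponent below q can be read off.
    product-injectiveʳ : ∀ i i′ k k′ → product i k ≈ product i′ k′ → k ≡ k′
    product-injectiveʳ i i′ k k′ eq = Fin.toℕ-injective (ℕ.suc-injective (root-^-injective {q} {η ^ n}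
      (^-primitive-coprime {q} {n} {η} (Coprimality.sym n⊥q) η-primitive) (1+k<q k) (1+k<q k′) (begin
        (η ^ n) ^ suc (toℕ k)    ≈⟨ product-^n i k ⟨
        product i k ^ n          ≈⟨ ^-congˡ n eq ⟩
        product i′ k′ ^ n        ≈⟨ product-^n i′ k′ ⟩
        (η ^ n) ^ suc (toℕ k′)   ∎)))

    product-injectiveˡ : ∀ i i′ k → product i k ≈ product i′ k → i ≡ i′
    product-injectiveˡ i i′ k eq = lookup-injective (distinct listsA)
      (root-cancelˡ {q} {η ^ suc (toℕ k)} ηᵏ^q≈1 (begin
        η ^ suc (toℕ k) * lookup A i   ≈⟨ *-comm _ _ ⟩
        product i k                    ≈⟨ eq ⟩
        product i′ k                   ≈⟨ *-comm _ _ ⟩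
        η ^ suc (toℕ k) * lookup A i′  ∎))
      where
      ηᵏ^q≈1 : (η ^ suc (toℕ k)) ^ q ≈ 1#
      ηᵏ^q≈1 = trans (^-assocʳ η (suc (toℕ k)) q) (∣⇒z^m≈1 η q (proj₁ η-primitive) (ℕ.n∣m*n (suc (toℕ k))))

    product-injective : ∀ i i′ k k′ → product i k ≈ product i′ k′ → (i , k) ≡ (i′ , k′)
    product-injective i i′ k k′ eq = helper (product-injectiveʳ i i′ k k′ eq) eq
      where
      helper : k ≡ k′ → product i k ≈ product i′ k′ → (i , k) ≡ (i′ , k′)
      helper ≡.refl eq = ≡.cong (_, k) (product-injectiveˡ i i′ k eq)

    -- Pigeonhole: pairs are coded in a single `Fin`, and equal positions in `B` mean equal
    -- products, hence equal pairs.
    [q-1]*∣A∣≤∣B∣ : length A ℕ.* ℕ.pred q ℕ.≤ length B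
    [q-1]*∣A∣≤∣B∣ = Fin.injective⇒≤ {f = position} λ {x} {y} eq →
      ≡.trans (≡.sym (Fin.combine-remQuot {length A} (ℕ.pred q) x)) (≡.trans
        (≡.cong (uncurry combine) (product-injective (quotient x) (quotient y) (remainder x) (remainder y)
          (Membership.index-injective ℂ-setoid (∈B x) (∈B y) eq)))
        (Fin.combine-remQuot {length A} (ℕ.pred q) y))
      where
      quotient : Fin (length A ℕ.* ℕ.pred q) → Fin (length A)
      quotient x = proj₁ (remQuot {length A} (ℕ.pred q) x)
      remainder : Fin (length A ℕ.* ℕ.pred q) → Fin (ℕ.pred q)
      remainder x = proj₂ (remQuot {length A} (ℕ.pred q) x)
      ∈B : ∀ x → product (quotient x) (remainder x) ∈ B
      ∈B x = product∈B (quotient x) (remainder x)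
      position : Fin (length A ℕ.* ℕ.pred q) → Fin (length B)
      position x = index (∈B x)

    q*∣A∣≤∣B++A∣ : q ℕ.* length A ℕ.≤ length (B ++ A)
    q*∣A∣≤∣B++A∣ = ≡.subst (q ℕ.* length A ℕ.≤_) (≡.sym (List.length-++ B))
      (a*pred[q]≤b⇒q*a≤b+a q (length A) (length B) [q-1]*∣A∣≤∣B∣)

    -- A common element would satisfy z^n = 1 with n < nq, against its order nq.
    distinct-B++A : Unique (B ++ A)
    distinct-B++A = Unique.++⁺ ℂ-setoid (distinct listsB) (distinct listsA) λ {z} (z∈B , z∈A) →
      proj₂ (sound listsB z z∈B) n (ℕ.>-nonZero⁻¹ n)
        (ℕ.m<m*n n q (ℕ.nonTrivial⇒n>1 q {{prime⇒nonTrivial q-prime}})) (proj₁ (sound listsA z z∈A))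

    roots : All (λ w → over w (dilate q (eSeries A)) (q ℕ.* length A) ≈ 0#) (B ++ A)
    roots = All.++⁺
      (All.tabulateₛ ℂ-setoid λ w∈B → root (^-primitive-* {n} {q} (sound listsB _ w∈B)))
      (All.tabulateₛ ℂ-setoid λ w∈A → root (^-primitive-coprime {n} {q} n⊥q (sound listsA _ w∈A)))
      where
      root : ∀ {w} → IsPrimitiveRoot n (w ^ q) → over w (dilate q (eSeries A)) (q ℕ.* length A) ≈ 0#
      root {w} prim = trans (over-dilate q w (eSeries A) (length A)) (eSeries-root A (complete listsA (w ^ q) prim))

  primitive-roots-product : length (B ++ A) ≡ q ℕ.* length A × dilate q (eSeries A) ≋ eSeries (B ++ A)
  primitive-roots-product = eSeries-unique ℂ-domain 1≉0 (q ℕ.* length A) (dilate q (eSeries A)) (B ++ A)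
    (trans (dilate-zero q (eSeries A)) (eSeries-zero A))
    (dilate-vanishes q (eSeries A) (length A) (eSeries-vanishes A))
    distinct-B++A roots q*∣A∣≤∣B++A∣

-- One and two primes

lists-1 : Lists𝓩* 1 (1# ∷ [])
lists-1 .nonempty = s≤s z≤n
lists-1 .distinct = [] ∷ []
lists-1 .sound z (here z≈1) = trans (*-identityʳ z) z≈1 , λ { (suc k) _ (s≤s ()) }
lists-1 .complete z (z¹≈1 , _) = here (trans (sym (*-identityʳ z)) z¹≈1)

-- The series 1 / (1 - x), that is, H for order 1.
ones : Series
ones = hSeries (1# ∷ [])

ones≈1 : ∀ k → ones k ≈ 1#
ones≈1 zero    = ≈-refl
ones≈1 (suc k) = trans (+-identityˡ _) (trans (*-identityˡ _) (ones≈1 k))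

shift : Series → Series
shift f zero    = 0#
shift f (suc n) = f n

times-1 : ∀ f n → times 1# f n ≈ f n - shift f n
times-1 f zero    = sym (trans (+-congˡ -0#≈0#) (+-identityʳ _))
times-1 f (suc n) = +-congˡ (-1*x≈-x (f n))

module _ {p : ℕ} (p-prime : Prime p) {Z : List ℂ} (lists : Lists𝓩* p Z) where

  private
    instance
      p≢0 : NonZero p
      p≢0 = prime⇒nonZero p-prime

    roots-of-unity : length (Z ++ 1# ∷ []) ≡ p ℕ.* 1 × dilate p (eSeries (1# ∷ [])) ≋ eSeries (Z ++ 1# ∷ [])
    roots-of-unity = primitive-roots-product p-prime (prime∤⇒coprime p-prime (<⇒∤ (prime⇒1< p-prime))) lists-1
      (≡.subst (λ n → Lists𝓩* n Z) (≡.sym (ℕ.*-identityˡ p)) lists)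

    e : eSeries (Z ++ 1# ∷ []) ≋ dilate p (eSeries (1# ∷ []))
    e n = sym (proj₂ roots-of-unity n)

  length-prime : suc (length Z) ≡ p
  length-prime = ≡.trans (ℕ.+-comm 1 (length Z)) (≡.trans (≡.sym (List.length-++ Z))
    (≡.trans (proj₁ roots-of-unity) (ℕ.*-identityʳ p)))

  -- Here E_p = (1 - x^p) / (1 - x), and below degree p the numerator acts as 1.
  eSeries-prime-< : ∀ {k} → k ℕ.< p → eSeries Z k ≈ 1#
  eSeries-prime-< {k} k<p = begin
    eSeries Z k                                   ≈⟨ eSeries-quotient {p} {1# ∷ []} {Z} e k ⟩
    (dilate p (eSeries (1# ∷ [])) ⊛ ones) k       ≈⟨ dilate-⊛-< p (eSeries (1# ∷ [])) ones k<p ⟩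
    1# * ones k                                   ≈⟨ *-identityˡ (ones k) ⟩
    ones k                                        ≈⟨ ones≈1 k ⟩
    1#                                            ∎

  eSeries-prime-≥ : ∀ {k} → p ℕ.≤ k → eSeries Z k ≈ 0#
  eSeries-prime-≥ {k} p≤k = eSeries-vanishes Z k (≡.subst (ℕ._≤ k) (≡.sym length-prime) p≤k)

  eSeries-prime : ∀ k → eSeries Z k ≈ fromℤ (𝟏P p (+ k))
  eSeries-prime k with k ℕ.<? p
  ... | yes k<p = trans (eSeries-prime-< k<p) (reflexive (≡.cong fromℤ (≡.sym (𝟏P-< k<p))))
  ... | no  k≮p = trans (eSeries-prime-≥ (ℕ.≮⇒≥ k≮p)) (reflexive (≡.cong fromℤ (≡.sym (𝟏P-≥ (ℕ.≮⇒≥ k≮p)))))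

  -- The series 1 / (1 - x^p).
  multiples : Series
  multiples = dilate p ones

  multiples-∣ : ∀ {k} → p ∣ k → multiples k ≈ 1#
  multiples-∣ {k} p∣k = trans
    (reflexive (≡.cong (λ r → at r (ones (k ℕ./ p))) (ℕ.n∣m⇒m%n≡0 k p p∣k))) (ones≈1 (k ℕ./ p))

  multiples-∤ : ∀ {k} → p ∤ k → multiples k ≈ 0#
  multiples-∤ {k} p∤k with k ℕ.% p in eq
  ... | zero  = contradiction (ℕ.m%n≡0⇒n∣m k p eq) p∤k
  ... | suc _ = ≈-refl

  hSeries-prime : ∀ k → hSeries Z k ≈ multiples k - shift multiples k
  hSeries-prime k = begin
    hSeries Z k                      ≈⟨ hSeries-quotient {p} {1# ∷ []} {Z} e k ⟩
    (multiples ⊛ times 1# δ) k       ≈⟨ ⊛-comm multiples (times 1# δ) k ⟩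
    (times 1# δ ⊛ multiples) k       ≈⟨ times-⊛ 1# δ multiples k ⟩
    times 1# (δ ⊛ multiples) k       ≈⟨ times-cong ≈-refl (⊛-identityˡ multiples) k ⟩
    times 1# multiples k             ≈⟨ times-1 multiples k ⟩
    multiples k - shift multiples k  ∎

-- `Δ` subtracts two indicators, so four computations with constants settle compatibility with
-- subtraction.
fromℤ-if-minus : ∀ b c → fromℤ ((if b then 1ℤ else 0ℤ) ℤ.- (if c then 1ℤ else 0ℤ)) ≈
                         fromℤ (if b then 1ℤ else 0ℤ) - fromℤ (if c then 1ℤ else 0ℤ)
fromℤ-if-minus true  true  = ≈ᴿ-pointwise (λ _ → ≡.refl) , ≈ᴿ-pointwise (λ _ → ≡.refl)
fromℤ-if-minus true  false = ≈ᴿ-pointwise (λ _ → ≡.refl) , ≈ᴿ-pointwise (λ _ → ≡.refl)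
fromℤ-if-minus false true  = ≈ᴿ-pointwise (λ _ → ≡.refl) , ≈ᴿ-pointwise (λ _ → ≡.refl)
fromℤ-if-minus false false = ≈ᴿ-pointwise (λ _ → ≡.refl) , ≈ᴿ-pointwise (λ _ → ≡.refl)

fromℤ-𝟏-minus : ∀ a b x y →
  fromℤ (𝟏[ a , b ] x ℤ.- 𝟏[ a , b ] y) ≈ fromℤ (𝟏[ a , b ] x) - fromℤ (𝟏[ a , b ] y)
fromℤ-𝟏-minus a b x y = fromℤ-if-minus (does ((a ℤ.≤? x) ×-dec (x ℤ.≤? b))) (does ((a ℤ.≤? y) ×-dec (y ℤ.≤? b)))

∑<-indicator : ∀ N b (F : ℕ → ℂ) → 0ℤ ℤ.≤ b →
  (∀ j → j ℕ.≤ N → b ≡ + j → F j ≈ 1#) → (∀ j → j ℕ.≤ N → b ≢ + j → F j ≈ 0#) →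
  ∑< (suc N) F ≈ fromℤ (𝟏[ 0ℤ , + N ] b)
∑<-indicator N (+ β) F 0≤β F≈1 F≈0 with β ℕ.≤? N
... | yes β≤N = begin
  ∑< (suc N) F
    ≈⟨ ∑<-single (suc N) β (s≤s β≤N)
         (λ { j (s≤s j≤N) j≢β → F≈0 j j≤N (j≢β ∘ ≡.sym ∘ ℤ.+-injective) }) ⟩
  F β                            ≈⟨ F≈1 β β≤N ≡.refl ⟩
  fromℤ 1ℤ                       ≡⟨ ≡.cong fromℤ (𝟏-∈ {0ℤ} {+ N} (ℤ.+≤+ z≤n) (ℤ.+≤+ β≤N)) ⟨
  fromℤ (𝟏[ 0ℤ , + N ] (+ β))    ∎
... | no β≰N = begin
  ∑< (suc N) F                   ≈⟨ ∑<-zero (suc N) (λ { j (s≤s j≤N) → F≈0 j j≤N λ { ≡.refl → β≰N j≤N } }) ⟩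
  fromℤ 0ℤ                       ≡⟨ ≡.cong fromℤ (𝟏-∉ {0ℤ} {+ N} (λ β≤N → β≰N (ℤ.drop‿+≤+ β≤N))) ⟨
  fromℤ (𝟏[ 0ℤ , + N ] (+ β))    ∎

-- `F` is the true coefficient and `T` its closed form, needed only where `P` holds; elsewhere the
-- coefficient vanishes.
∑-filter : ∀ {ℓ} {P : Pred ℕ ℓ} (P? : Decidable P) (T F : ℕ → ℂ) n →
  (∀ i → i ℕ.< n → P i → F i ≈ T i) → (∀ i → i ℕ.< n → ¬ P i → F i ≈ 0#) →
  ∑< n F ≈ ∑[ i ∈ filter P? (upTo n) ] T i
∑-filter {P = P} P? T F n = go n id
  where
  go : ∀ n (g : ℕ → ℕ) →
    (∀ i → i ℕ.< n → P (g i) → F (g i) ≈ T (g i)) → (∀ i → i ℕ.< n → ¬ P (g i) → F (g i) ≈ 0#) →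
    ∑< n (F ∘ g) ≈ ∑[ i ∈ filter P? (applyUpTo g n) ] T i
  go zero    g yesᵖ noᵖ = ≈-refl
  go (suc n) g yesᵖ noᵖ
    with P? (g 0) | go n (g ∘ suc) (λ i i<n → yesᵖ (suc i) (s≤s i<n)) (λ i i<n → noᵖ (suc i) (s≤s i<n))
  ... | yes Pg0 | rec = +-cong (yesᵖ 0 (s≤s z≤n) Pg0) rec
  ... | no ¬Pg0 | rec = trans (+-cong (noᵖ 0 (s≤s z≤n) ¬Pg0) rec) (+-identityˡ _)

∑<≈∑upTo : ∀ n {F G : ℕ → ℂ} → (∀ i → i ℕ.< n → F i ≈ G i) → ∑< n F ≈ ∑[ i ∈ upTo n ] G i
∑<≈∑upTo n {F} {G} F≈G = trans (∑<-cong n F≈G)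
  (reflexive (≡.cong (List.foldr _+_ 0#) (≡.sym (List.map-upTo G n))))

∑<-last : ∀ N (F : ℕ → ℂ) → (∀ j → j ℕ.< N → F j ≈ 0#) → ∑< (suc N) F ≈ F N
∑<-last N F F≈0 = ∑<-single (suc N) N ℕ.≤-refl (λ { j (s≤s j≤N) j≢N → F≈0 j (ℕ.≤∧≢⇒< j≤N j≢N) })

module _ {p q : ℕ} .{{_ : NonZero q}} (p-prime : Prime p) (q-prime : Prime q) (p<q : p ℕ.< q)
         {Z₁ Z₁₂ : List ℂ} (lists₁ : Lists𝓩* p Z₁) (lists₁₂ : Lists𝓩* (p ℕ.* q) Z₁₂) where

  private
    instance
      p≢0 : NonZero p
      p≢0 = prime⇒nonZero p-prime

    p⊥q : Coprime p q
    p⊥q = prime∤⇒coprime q-prime (<⇒∤ p<q)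

    roots-of-unity : length (Z₁₂ ++ Z₁) ≡ q ℕ.* length Z₁ × dilate q (eSeries Z₁) ≋ eSeries (Z₁₂ ++ Z₁)
    roots-of-unity = primitive-roots-product q-prime p⊥q lists₁ lists₁₂

    e : eSeries (Z₁₂ ++ Z₁) ≋ dilate q (eSeries Z₁)
    e n = sym (proj₂ roots-of-unity n)

  length-two-primes : length Z₁₂ ≡ length Z₁ ℕ.* ℕ.pred q
  length-two-primes = b+a≡q*a⇒b≡a*pred[q] q (length Z₁) (length Z₁₂)
    (≡.trans (≡.sym (List.length-++ Z₁₂)) (proj₁ roots-of-unity))

  -- E_p has degree p - 1 < q, so among the indices m - jq only the smallest, the remainder of m
  -- modulo q, can contribute.
  hSeries-two-primes : ∀ m → hSeries Z₁₂ m ≈ fromℤ (𝟏P p (+ (m ℕ.% q))) * hSeries Z₁ (m ℕ./ q)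
  hSeries-two-primes m = begin
    hSeries Z₁₂ m                                        ≈⟨ hSeries-quotient {q} {Z₁} {Z₁₂} e m ⟩
    (dilate q (hSeries Z₁) ⊛ eSeries Z₁) m               ≈⟨ dilate-⊛-sum q (hSeries Z₁) (eSeries Z₁) m ⟩
    ∑< (suc N) (λ j → hSeries Z₁ j * eSeries Z₁ (m ∸ j ℕ.* q))
      ≈⟨ ∑<-last N (λ j → hSeries Z₁ j * eSeries Z₁ (m ∸ j ℕ.* q)) (λ j j<N →
           trans (*-congˡ {hSeries Z₁ j} (eSeries-prime-≥ p-prime lists₁ (p≤ j j<N))) (zeroʳ _)) ⟩
    hSeries Z₁ N * eSeries Z₁ (m ∸ N ℕ.* q)
      ≡⟨ ≡.cong (λ k → hSeries Z₁ N * eSeries Z₁ k) (ℕ.m%n≡m∸m/n*n m q) ⟨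
    hSeries Z₁ N * eSeries Z₁ (m ℕ.% q)                  ≈⟨ *-comm _ _ ⟩
    eSeries Z₁ (m ℕ.% q) * hSeries Z₁ N                  ≈⟨ *-congʳ (eSeries-prime p-prime lists₁ (m ℕ.% q)) ⟩
    fromℤ (𝟏P p (+ (m ℕ.% q))) * hSeries Z₁ N            ∎
    where
    N = m ℕ./ q
    p≤ : ∀ j → j ℕ.< N → p ℕ.≤ m ∸ j ℕ.* q
    p≤ j j<N = ℕ.≤-trans (ℕ.<⇒≤ p<q) (ℕ.m+n≤o⇒m≤o∸n q
      (ℕ.≤-trans (ℕ.*-monoˡ-≤ q j<N) (ℕ.m/n*n≤m m q)))

  module _ (b₀ b₁ : ℤ → ℤ) (solves₀ : ∀ j → SolvesMod p q j (b₀ j))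
           (solves₁ : ∀ j → SolvesMod p q (j ℤ.- 1ℤ) (b₁ j)) where

    -- The bound on n gives n < pq, so every j ≤ n / q is below p. Hence the coefficients of E_p
    -- that occur are 1, and each congruence has at most one solution j in the range.
    eSeries-two-primes : ∀ n → n ℕ.≤ length Z₁₂ → eSeries Z₁₂ n ≈ fromℤ (Δ q b₀ b₁ (+ n))
    eSeries-two-primes n n≤ = begin
      eSeries Z₁₂ n                                        ≈⟨ eSeries-quotient {q} {Z₁} {Z₁₂} e n ⟩
      (dilate q (eSeries Z₁) ⊛ hSeries Z₁) n               ≈⟨ dilate-⊛-sum q (eSeries Z₁) (hSeries Z₁) n ⟩
      ∑< (suc N) (λ j → eSeries Z₁ j * hSeries Z₁ (n ∸ j ℕ.* q))
        ≈⟨ ∑<-cong (suc N) (λ { j (s≤s j≤N) → trans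
             (*-cong (eSeries-prime-< p-prime lists₁ (j<p j j≤N)) (hSeries-prime p-prime lists₁ (n ∸ j ℕ.* q)))
             (*-identityˡ _) }) ⟩
      ∑< (suc N) (λ j → M (n ∸ j ℕ.* q) - shift M (n ∸ j ℕ.* q))
        ≈⟨ ∑<-distrib-minus (suc N) (λ j → M (n ∸ j ℕ.* q)) (λ j → shift M (n ∸ j ℕ.* q)) ⟩
      ∑< (suc N) (λ j → M (n ∸ j ℕ.* q)) - ∑< (suc N) (λ j → shift M (n ∸ j ℕ.* q))
        ≈⟨ +-cong first (-‿cong second) ⟩
      fromℤ (𝟏[ 0ℤ , + N ] (b₀ (+ n))) - fromℤ (𝟏[ 0ℤ , + N ] (b₁ (+ n)))
        ≈⟨ fromℤ-𝟏-minus 0ℤ (+ N) (b₀ (+ n)) (b₁ (+ n)) ⟨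
      fromℤ (Δ q b₀ b₁ (+ n)) ∎
      where
      N = n ℕ./ q
      M = multiples p-prime lists₁
      j<p : ∀ j → j ℕ.≤ N → j ℕ.< p
      j<p j j≤N = ℕ.≤-<-trans j≤N (ℕ.m<n*o⇒m/o<n n<p*q)
        where
        n<p*q : n ℕ.< p ℕ.* q
        n<p*q = ℕ.≤-<-trans
          (ℕ.≤-trans n≤ (ℕ.≤-trans (ℕ.≤-reflexive length-two-primes) (ℕ.*-monoʳ-≤ (length Z₁) ℕ.pred[n]≤n)))
          (ℕ.*-monoˡ-< q (ℕ.≤-reflexive (length-prime p-prime lists₁)))
      j*q≤n : ∀ j → j ℕ.≤ N → j ℕ.* q ℕ.≤ n
      j*q≤n j j≤N = ℕ.≤-trans (ℕ.*-monoˡ-≤ q j≤N) (ℕ.m/n*n≤m n q)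
      residue : ∀ j → j ℕ.≤ N → + n ℤ.- + q ℤ.* + j ≡ + (n ∸ j ℕ.* q)
      residue j j≤N = ≡.trans
        (≡.cong (λ x → + n ℤ.- x) (≡.trans (≡.sym (ℤ.pos-* q j)) (≡.cong +_ (ℕ.*-comm q j))))
        (+m-+n (j*q≤n j j≤N))
      first : ∑< (suc N) (λ j → M (n ∸ j ℕ.* q)) ≈ fromℤ (𝟏[ 0ℤ , + N ] (b₀ (+ n)))
      first = ∑<-indicator N (b₀ (+ n)) _ (proj₁ (solves₀ (+ n)))
        (λ j j≤N b≡j → multiples-∣ p-prime lists₁
          (≡.subst (+ p ℤ.∣_) (residue j j≤N) (≡⇒∣-residue p q (+ n) (b₀ (+ n)) j (solves₀ (+ n)) b≡j)))
        (λ j j≤N b≢j → multiples-∤ p-prime lists₁ λ p∣ → b≢j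
          (∣-residue⇒≡ p q (+ n) (b₀ (+ n)) j (solves₀ (+ n)) p⊥q (j<p j j≤N)
          (≡.subst (+ p ℤ.∣_) (≡.sym (residue j j≤N)) p∣)))
      residue-1 : ∀ j → j ℕ.≤ N → + n ℤ.- 1ℤ ℤ.- + q ℤ.* + j ≡ + (n ∸ j ℕ.* q) ℤ.- 1ℤ
      residue-1 j j≤N = ≡.trans (i-j-k≡i-k-j (+ n) 1ℤ (+ q ℤ.* + j)) (≡.cong (λ x → x ℤ.- 1ℤ) (residue j j≤N))
      shift-∣ : ∀ k → + p ℤ.∣ (+ k ℤ.- 1ℤ) → shift M k ≈ 1#
      -- At index 0 the shifted series vanishes, in accordance with p not dividing -1.
      shift-∣ zero    p∣-1 = contradiction p∣-1 (<⇒∤ (prime⇒1< p-prime))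
      shift-∣ (suc k) p∣k  = multiples-∣ p-prime lists₁ p∣k
      shift-∤ : ∀ k → ¬ (+ p ℤ.∣ (+ k ℤ.- 1ℤ)) → shift M k ≈ 0#
      shift-∤ zero    p∤-1 = ≈-refl
      shift-∤ (suc k) p∤k  = multiples-∤ p-prime lists₁ p∤k
      second : ∑< (suc N) (λ j → shift M (n ∸ j ℕ.* q)) ≈ fromℤ (𝟏[ 0ℤ , + N ] (b₁ (+ n)))
      second = ∑<-indicator N (b₁ (+ n)) _ (proj₁ (solves₁ (+ n)))
        (λ j j≤N b≡j → shift-∣ (n ∸ j ℕ.* q)
          (≡.subst (+ p ℤ.∣_) (residue-1 j j≤N) (≡⇒∣-residue p q (+ n ℤ.- 1ℤ) (b₁ (+ n)) j (solves₁ (+ n)) b≡j)))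
        (λ j j≤N b≢j → shift-∤ (n ∸ j ℕ.* q) λ p∣ → b≢j
          (∣-residue⇒≡ p q (+ n ℤ.- 1ℤ) (b₁ (+ n)) j (solves₁ (+ n)) p⊥q (j<p j j≤N)
          (≡.subst (+ p ℤ.∣_) (≡.sym (residue-1 j j≤N)) p∣)))

-- Three primes and the four identities

corollary1p10 : (m p₁ p₂ p₃ : ℕ) .{{_ : NonZero p₂}} .{{_ : NonZero p₃}} →
    Prime p₁ → Prime p₂ → Prime p₃ → p₁ ℕ.< p₂ → p₂ ℕ.< p₃ →
    (b₀ b₁ : ℤ → ℤ) →
    (∀ j → SolvesMod p₁ p₂ j (b₀ j)) →
    (∀ j → SolvesMod p₁ p₂ (j ℤ.- 1ℤ) (b₁ j)) →
    (Z₁ Z₁₂ Z₁₂₃ : List ℂ) →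
    Lists𝓩* p₁ Z₁ → Lists𝓩* (p₁ ℕ.* p₂) Z₁₂ → Lists𝓩* (p₁ ℕ.* p₂ ℕ.* p₃) Z₁₂₃ →
    (𝓗 m Z₁₂ ≈ fromℤ (𝟏P p₁ (+ (m ℕ.% p₂))) * 𝓗 (m ℕ./ p₂) Z₁)
    ×
    (m ℕ.≤ length Z₁₂ →
    (- 1#) ^ m * 𝓔 m Z₁₂ ≈ fromℤ (Δ p₂ b₀ b₁ (+ m)))
    ×
    (𝓗 m Z₁₂₃ ≈
    ∑[ j ∈ I m p₁ p₂ p₃ ]
    fromℤ (𝟏P p₁ (+ (j ℕ.% p₂))) * fromℤ (Δ p₂ b₀ b₁ (+ m ℤ.- + (j ℕ.* p₃))) * 𝓗 (j ℕ./ p₂) Z₁)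
    ×
    (m ℕ.≤ length Z₁₂₃ →
    (- 1#) ^ m * 𝓔 m Z₁₂₃ ≈
    ∑[ j ∈ upTo (suc (m ℕ./ p₃)) ]
    fromℤ (𝟏P p₁ (+ ((m ℕ.∸ j ℕ.* p₃) ℕ.% p₂))) * fromℤ (Δ p₂ b₀ b₁ (+ j))
    * 𝓗 ((m ℕ.∸ j ℕ.* p₃) ℕ./ p₂) Z₁)
corollary1p10 m p₁ p₂ p₃ prime₁ prime₂ prime₃ p₁<p₂ p₂<p₃ b₀ b₁ solves₀ solves₁
  Z₁ Z₁₂ Z₁₂₃ lists₁ lists₁₂ lists₁₂₃ =
  𝓗₁₂ m , 𝓔₁₂ , 𝓗₁₂₃ , 𝓔₁₂₃
  where
  instance
    p₁≢0 : NonZero p₁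
    p₁≢0 = prime⇒nonZero prime₁

  p₃∤p₁p₂ : p₃ ∤ p₁ ℕ.* p₂
  p₃∤p₁p₂ p₃∣p₁p₂ =
    [ <⇒∤ (ℕ.<-trans p₁<p₂ p₂<p₃) , <⇒∤ p₂<p₃ ]′ (euclidsLemma p₁ p₂ prime₃ p₃∣p₁p₂)

  roots-of-unity : length (Z₁₂₃ ++ Z₁₂) ≡ p₃ ℕ.* length Z₁₂ × dilate p₃ (eSeries Z₁₂) ≋ eSeries (Z₁₂₃ ++ Z₁₂)
  roots-of-unity = primitive-roots-product {{ℕ.m*n≢0 p₁ p₂}} prime₃ (prime∤⇒coprime prime₃ p₃∤p₁p₂) lists₁₂ lists₁₂₃

  e : eSeries (Z₁₂₃ ++ Z₁₂) ≋ dilate p₃ (eSeries Z₁₂)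
  e n = sym (proj₂ roots-of-unity n)

  N : ℕ
  N = m ℕ./ p₃

  hSeries₁₂ : ∀ m → hSeries Z₁₂ m ≈ fromℤ (𝟏P p₁ (+ (m ℕ.% p₂))) * 𝓗 (m ℕ./ p₂) Z₁
  hSeries₁₂ m = trans (hSeries-two-primes prime₁ prime₂ p₁<p₂ lists₁ lists₁₂ m)
    (*-congˡ (sym (𝓗≈hSeries (m ℕ./ p₂) Z₁)))

  eSeries₁₂ : ∀ n → n ℕ.≤ length Z₁₂ → eSeries Z₁₂ n ≈ fromℤ (Δ p₂ b₀ b₁ (+ n))
  eSeries₁₂ = eSeries-two-primes prime₁ prime₂ p₁<p₂ lists₁ lists₁₂ b₀ b₁ solves₀ solves₁

  𝓗₁₂ : ∀ m → 𝓗 m Z₁₂ ≈ fromℤ (𝟏P p₁ (+ (m ℕ.% p₂))) * 𝓗 (m ℕ./ p₂) Z₁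
  𝓗₁₂ m = trans (𝓗≈hSeries m Z₁₂) (hSeries₁₂ m)

  𝓔₁₂ : m ℕ.≤ length Z₁₂ → (- 1#) ^ m * 𝓔 m Z₁₂ ≈ fromℤ (Δ p₂ b₀ b₁ (+ m))
  𝓔₁₂ m≤ = trans (𝓔≈eSeries m Z₁₂) (eSeries₁₂ m m≤)

  rearrange : ∀ {x y a b c} → x ≈ c → y ≈ a * b → x * y ≈ a * c * b
  rearrange {x} {y} {a} {b} {c} x≈c y≈ab = begin
    x * y        ≈⟨ *-cong x≈c y≈ab ⟩
    c * (a * b)  ≈⟨ *-assoc c a b ⟨
    c * a * b    ≈⟨ *-congʳ (*-comm c a) ⟩
    a * c * b    ∎

  -- The constant in `I` is the degree of E_{p₁p₂}: the lower end of the interval says that m - jp₃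
  -- does not exceed this degree.
  length₁₂ : (+ p₁ ℤ.- 1ℤ) ℤ.* (+ p₂ ℤ.- 1ℤ) ≡ + length Z₁₂
  length₁₂ = ≡.trans (pred-* p₁ p₂) (≡.cong +_ (≡.sym (≡.trans
    (length-two-primes prime₁ prime₂ p₁<p₂ lists₁ lists₁₂)
    (≡.cong (λ a → a ℕ.* ℕ.pred p₂) (≡.cong ℕ.pred (length-prime prime₁ lists₁))))))
    where
    pred-* : ∀ p q .{{_ : NonZero p}} .{{_ : NonZero q}} →
      (+ p ℤ.- 1ℤ) ℤ.* (+ q ℤ.- 1ℤ) ≡ + (ℕ.pred p ℕ.* ℕ.pred q)
    pred-* (suc p) (suc q) = ≡.sym (ℤ.pos-* p q)

  𝓗₁₂₃ : 𝓗 m Z₁₂₃ ≈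
    ∑[ j ∈ I m p₁ p₂ p₃ ]
    fromℤ (𝟏P p₁ (+ (j ℕ.% p₂))) * fromℤ (Δ p₂ b₀ b₁ (+ m ℤ.- + (j ℕ.* p₃))) * 𝓗 (j ℕ./ p₂) Z₁
  𝓗₁₂₃ = begin
    𝓗 m Z₁₂₃                                   ≈⟨ 𝓗≈hSeries m Z₁₂₃ ⟩
    hSeries Z₁₂₃ m                             ≈⟨ hSeries-quotient {p₃} {Z₁₂} {Z₁₂₃} e m ⟩
    (dilate p₃ (hSeries Z₁₂) ⊛ eSeries Z₁₂) m  ≈⟨ dilate-⊛-sum p₃ (hSeries Z₁₂) (eSeries Z₁₂) m ⟩
    ∑< (suc N) summand
      ≈⟨ ∑-filter (λ j → bound ℚ.≤? (+ j ℚ./ 1)) term summand (suc N) inside outside ⟩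
    ∑[ j ∈ I m p₁ p₂ p₃ ] term j               ∎
    where
    summand term : ℕ → ℂ
    summand j = hSeries Z₁₂ j * eSeries Z₁₂ (m ∸ j ℕ.* p₃)
    term j = fromℤ (𝟏P p₁ (+ (j ℕ.% p₂))) * fromℤ (Δ p₂ b₀ b₁ (+ m ℤ.- + (j ℕ.* p₃))) * 𝓗 (j ℕ./ p₂) Z₁

    bound : ℚ
    bound = (+ m ℚ./ p₃) ℚ.- (((+ p₁ ℤ.- 1ℤ) ℤ.* (+ p₂ ℤ.- 1ℤ)) ℚ./ p₃)

    bound≡ : bound ≡ (+ m ℚ./ p₃) ℚ.- (+ length Z₁₂ ℚ./ p₃)
    bound≡ = ≡.cong (λ y → (+ m ℚ./ p₃) ℚ.- (y ℚ./ p₃)) length₁₂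

    inside : ∀ j → j ℕ.< suc N → bound ℚ.≤ (+ j ℚ./ 1) → summand j ≈ term j
    inside j (s≤s j≤N) bound≤j = trans (*-comm _ _) (rearrange
      (trans (eSeries₁₂ (m ∸ j ℕ.* p₃) (fraction-≤⇒∸-≤ m (length Z₁₂) j p₃
          (≡.subst (ℚ._≤ (+ j ℚ./ 1)) bound≡ bound≤j)))
        (reflexive (≡.cong (λ x → fromℤ (Δ p₂ b₀ b₁ x))
          (≡.sym (+m-+n (ℕ.≤-trans (ℕ.*-monoˡ-≤ p₃ j≤N) (ℕ.m/n*n≤m m p₃)))))))
      (hSeries₁₂ j))

    outside : ∀ j → j ℕ.< suc N → ¬ bound ℚ.≤ (+ j ℚ./ 1) → summand j ≈ 0#
    outside j _ bound≰j = trans (*-congˡ {hSeries Z₁₂ j} (eSeries-vanishes Z₁₂ (m ∸ j ℕ.* p₃)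
      (ℕ.≰⇒> λ ≤length → bound≰j
      (≡.subst (ℚ._≤ (+ j ℚ./ 1)) (≡.sym bound≡) (∸-≤⇒fraction-≤ m (length Z₁₂) j p₃ ≤length))))) (zeroʳ _)

  𝓔₁₂₃ : m ℕ.≤ length Z₁₂₃ →
    (- 1#) ^ m * 𝓔 m Z₁₂₃ ≈
    ∑[ j ∈ upTo (suc (m ℕ./ p₃)) ]
    fromℤ (𝟏P p₁ (+ ((m ℕ.∸ j ℕ.* p₃) ℕ.% p₂))) * fromℤ (Δ p₂ b₀ b₁ (+ j))
    * 𝓗 ((m ℕ.∸ j ℕ.* p₃) ℕ./ p₂) Z₁
  𝓔₁₂₃ m≤ = begin
    (- 1#) ^ m * 𝓔 m Z₁₂₃                      ≈⟨ 𝓔≈eSeries m Z₁₂₃ ⟩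
    eSeries Z₁₂₃ m                             ≈⟨ eSeries-quotient {p₃} {Z₁₂} {Z₁₂₃} e m ⟩
    (dilate p₃ (eSeries Z₁₂) ⊛ hSeries Z₁₂) m  ≈⟨ dilate-⊛-sum p₃ (eSeries Z₁₂) (hSeries Z₁₂) m ⟩
    ∑< (suc N) (λ j → eSeries Z₁₂ j * hSeries Z₁₂ (m ∸ j ℕ.* p₃))
      -- The first identity is applied once, at m - jp₃. This yields one indicator and the index
      -- [(m - jp₃) / p₂]; the second indicator and second division by p₂ of the English formula do
      -- not arise.
      ≈⟨ ∑<≈∑upTo (suc N) (λ { j (s≤s j≤N) →
           rearrange (eSeries₁₂ j (ℕ.≤-trans j≤N N≤)) (hSeries₁₂ (m ∸ j ℕ.* p₃)) }) ⟩
    _ ∎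
    where
    -- The lengths of `Z₁₂₃` and `Z₁₂` add up to p₃ times that of `Z₁₂`, so the bound on m keeps
    -- every j within reach of the second identity.
    N≤ : N ℕ.≤ length Z₁₂
    N≤ = ℕ.≤-trans
      (ℕ./-monoˡ-≤ p₃ (ℕ.≤-trans m≤ (ℕ.≤-trans (ℕ.m≤m+n (length Z₁₂₃) (length Z₁₂)) (ℕ.≤-reflexive
        (≡.trans (≡.sym (List.length-++ Z₁₂₃)) (≡.trans (proj₁ roots-of-unity) (ℕ.*-comm p₃ (length Z₁₂))))))))
      (ℕ.≤-reflexive (ℕ.m*n/n≡m (length Z₁₂) p₃))
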